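{- Let $n\ge 1$ and let $R=(r_1,r_2,\ldots,r_n)$ be a feasible score sequence with normalized score vector $H_R=(h_1,\ldots,h_n)$, $h_i=r_i-(i-1)$. Then $|U_{\min}(R)|=1$ if and only if $H_R$ can be written as a concatenation $$H_R=(H_1,H_2,\ldots,H_m)$$ of finitely many (i.e. $m\ge 1$) consecutive segments, where every segment $H_i$, $i=1,\ldots,m$, is a symmetric vector (different segments may have different parameters $p_i$).
   Context: A tournament matrix of order $n$ is an $n\times n$ $(0,1)$-matrix $A=(a_{ij})$ with $A+A^{T}=J-I$, where $J$ is the all-ones matrix and $I$ the identity matrix (i.e. the adjacency matrix of an orientation of the complete graph on the ordered vertex set $\{1,\ldots,n\}$). Its score sequence is its row sum vector. A feasible score sequence of length $n$ is a nondecreasing integer vector $R=(r_1,\ldots,r_n)$ with $\sum_{i=1}^n r_i=\binom n2$ and $\sum_{i=1}^k r_i\ge\binom k2$ for $k=1,\ldots,n-1$. Let $\mathcal T(R)$ be the set of all $n\times n$ tournament matrices whose row sum vector is exactly $R$ (row $i$ has sum $r_i$). An upset of a tournament matrix $A=(a_{ij})$ is an entry $a_{ij}=1$ with $i<j$. $U_{\min}(R)$ denotes the set of all matrices in $\mathcal T(R)$ whose number of upsets is minimum among all matrices in $\mathcal T(R)$. The normalized score vector of $R$ is $H_R=(h_1,\ldots,h_n)$ with $h_i=r_i-(i-1)$. A (nonempty) integer vector $H$ is called symmetric if it is of the form $(0,\ldots,0)$ (one or more zeros), or of the form $(p,p-1,\ldots,1,0,\ldots,0,-1,-2,\ldots,-p)$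 for some positive integer $p$, with one or more zeros in the middle block. -}

module Defs where

open import Data.Bool.Base using (if_then_else_)
open import Data.Fin.Base as Fin using (Fin; toℕ)
import Data.Fin.Properties as Fin
open import Data.Integer.Base using (ℤ; +_; +[1+_]; -[1+_]; 0ℤ; 1ℤ; _+_; _-_; _≤_)
import Data.Integer.Properties as ℤ
open import Data.List.Base
  using (List; _++_; allFin; applyDownFrom; applyUpTo; cartesianProduct;
         concat; filter; foldr; length; replicate; take)
open import Data.List.Membership.Propositional using (_∈_)
open import Data.List.Relation.Unary.All using (All)
open import Data.List.Relation.Unary.Unique.Propositional using (Unique)
open import Data.Nat.Base as ℕ using (ℕ)
open import Data.Nat.Combinatorics using (_C_)
open import Data.Product.Base using (∃-syntax; _×_; _,_)
open import Data.Sum.Base using (_⊎_)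
open import Data.Vec.Base using (Vec; lookup; tabulate; toList)
open import Function.Bundles using (_⇔_)
open import Relation.Binary.PropositionalEquality.Core using (_≡_)
open import Relation.Nullary.Decidable.Core using (Dec; does; _×-dec_)

sumℤ : List ℤ → ℤ
sumℤ = foldr _+_ 0ℤ

-- Matrices are vectors of rows, rather than functions, so that _≡_ on them is
-- entrywise equality.
Matrix : ℕ → Set
Matrix n = Vec (Vec ℤ n) n

entry : ∀ {n} → Matrix n → Fin n → Fin n → ℤ
entry A i j = lookup (lookup A i) j

rowSum : ∀ {n} → Matrix n → Fin n → ℤ
rowSum A i = sumℤ (toList (lookup A i))

allOnes : ∀ {n} → Fin n → Fin n → ℤ
allOnes _ _ = 1ℤ

identity : ∀ {n} → Fin n → Fin n → ℤ
identity i j = if does (i Fin.≟ j) then 1ℤ else 0ℤ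

record IsTournament {n : ℕ} (A : Matrix n) : Set where
  field
    zero-one : ∀ i j → entry A i j ≡ 0ℤ ⊎ entry A i j ≡ 1ℤ
    A+Aᵀ≡J-I : ∀ i j → entry A i j + entry A j i ≡ allOnes i j - identity i j

record Feasible {n : ℕ} (R : Vec ℤ n) : Set where
  field
    nondecreasing : ∀ i j → i Fin.≤ j → lookup R i ≤ lookup R j
    total         : sumℤ (toList R) ≡ + (n C 2)
    partial       : ∀ k → 1 ℕ.≤ k → k ℕ.< n → + (k C 2) ≤ sumℤ (take k (toList R))

record 𝒯 {n : ℕ} (R : Vec ℤ n) (A : Matrix n) : Set where
  field
    tournament : IsTournament A
    scores     : ∀ i → rowSum A i ≡ lookup R i

IsUpset : ∀ {n} → Matrix n → Fin n × Fin n → Set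
IsUpset A (i , j) = i Fin.< j × entry A i j ≡ 1ℤ

isUpset? : ∀ {n} (A : Matrix n) ij → Dec (IsUpset A ij)
isUpset? A (i , j) = (i Fin.<? j) ×-dec (entry A i j ℤ.≟ 1ℤ)

upsets : ∀ {n} → Matrix n → ℕ
upsets {n} A = length (filter (isUpset? A) (cartesianProduct (allFin n) (allFin n)))

record Uₘᵢₙ {n : ℕ} (R : Vec ℤ n) (A : Matrix n) : Set where
  field
    member  : 𝒯 R A
    minimum : ∀ B → 𝒯 R B → upsets A ℕ.≤ upsets B

-- The set { x | P x } has exactly k elements: it is enumerated without
-- repetition by a list of length k.
HasCardinality : {X : Set} → (X → Set) → ℕ → Set
HasCardinality {X} P k =
  ∃[ xs ] Unique xs × length xs ≡ k × (∀ (x : X) → x ∈ xs ⇔ P x)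

-- Indices in Fin n start at 0, so toℕ i is the i - 1 of one-based indexing.
normalized : ∀ {n} → Vec ℤ n → Vec ℤ n
normalized R = tabulate λ i → lookup R i - + toℕ i

-- (p, p-1, …, 1, 0, …, 0, -1, -2, …, -p) with z zeros.
ramp : ℕ → ℕ → List ℤ
ramp p z = applyDownFrom (λ i → +[1+ i ]) p ++ replicate z 0ℤ ++ applyUpTo -[1+_] p

Symmetric : List ℤ → Set
Symmetric H =
    (∃[ z ] 1 ℕ.≤ z × H ≡ replicate z 0ℤ)
  ⊎ (∃[ p ] ∃[ z ] 1 ℕ.≤ p × 1 ℕ.≤ z × H ≡ ramp p z)

IsConcatenationOfSymmetric : List ℤ → Set
IsConcatenationOfSymmetric H =
  ∃[ Hs ] 1 ℕ.≤ length Hs × All Symmetric Hs × H ≡ concat Hs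

{-# OPTIONS --safe #-}

-- Since h_i counts the upsets won minus the upsets lost by i, a minimum is a
-- cheapest flow of divergence H_R on the arcs i → j with i < j.
--
-- If the minimum is unique, reversing any 3- or 4-cycle must increase the number
-- of upsets. As R is nondecreasing, it follows that i + 1 beats i, that at most
-- one vertex x is beaten by i but not by i + 1, and that in this case i + 1 beats
-- nothing else that i does not, whence h_{i+1} = h_i - 1. A vertex i that wins an
-- upset has such an x > i + 1: otherwise its upsets survive until the first step
-- that loses one, and there twins with the same nonempty set of upsets appear,
-- which contradicts uniqueness of x at the step before their first target. Hence
-- positive entries descend in unit steps to 0. If m is the only target of the last
-- vertex of such a run, no further sources occur before m, and the sets of upsets
-- lost by m, m - 1, … shrink one by one exactly as those won in the run do: the
-- entries up to m form a symmetric vector, and no upset crosses its end.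
--
-- Conversely, the tournament whose upsets are the pairs at distance at least p + z
-- inside the blocks (p, …, 1, 0^z, -1, …, -p) has normalized scores H_R. Linear
-- programming duality shows that it is the unique minimum.
module Submission where

open import Defs
open import Data.Integer.Base using (ℤ)
open import Data.Nat.Base using (ℕ; _≤_)
open import Data.Vec.Base using (Vec; toList)
open import Function.Bundles using (_⇔_)

open import Data.Bool.Base using (Bool; true; false; not; _∧_; _∨_; _xor_; T; if_then_else_)
import Data.Bool.Properties as Bool
open import Data.Empty using (⊥; ⊥-elim)
open import Data.Fin.Base as Fin using (Fin; toℕ; fromℕ<)
import Data.Fin.Properties as Fin
open import Data.Integer.Base as ℤ using (+_; +[1+_]; -[1+_]; 0ℤ; 1ℤ; -1ℤ)
  renaming (_+_ to _+ᶻ_; _-_ to _-ᶻ_; _*_ to _*ᶻ_; -_ to -ᶻ_; _≤_ to _≤ᶻ_; _<_ to _<ᶻ_)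
import Data.Integer.Properties as ℤ
open import Algebra.Properties.AbelianGroup ℤ.+-0-abelianGroup using (∙-cancelʳ)
open import Data.Integer.Tactic.RingSolver using (solve-∀)
open import Data.List.Base as List
  using (List; []; _∷_; _++_; allFin; applyUpTo; applyDownFrom; cartesianProduct;
         concat; filter; length; replicate)
import Data.List.Properties as List
open import Data.List.Relation.Unary.All using (All; []; _∷_)
open import Data.List.Relation.Unary.AllPairs using ([]; _∷_)
open import Data.List.Relation.Unary.Any using (here)
open import Data.Nat.Base
  using (zero; suc; _+_; _∸_; _<_; _<ᵇ_; _≡ᵇ_; z≤n; s≤s; s≤s⁻¹)
import Data.Nat.Properties as ℕ
open import Data.Product.Base using (∃-syntax; _×_; _,_; proj₁; proj₂)
open import Data.Sum.Base using (_⊎_; inj₁; inj₂)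
open import Data.Vec.Base using (lookup; tabulate)
import Data.Vec.Properties as Vec
open import Function.Base using (_∘_; case_of_; id)
open import Function.Bundles using (mk⇔; Equivalence)
open import Level using (0ℓ)
open import Relation.Binary.Definitions using (tri<; tri≈; tri>)
open import Relation.Binary.PropositionalEquality
open import Relation.Nullary using (¬_; Dec; yes; no; does; contradiction)
open import Relation.Nullary.Decidable using (_×-dec_; dec-true; dec-false)
open import Relation.Unary using (Pred; Decidable)

-- Tournaments without cheap cycle reversals

-- All natural numbers are vertices, so that `suc k` is always one. The order n enters only through
-- sums and bounds.
record Tournament (a : ℕ → ℕ → Bool) : Set where
  field
    irrefl : ∀ i → a i i ≡ false
    anti   : ∀ {i j} → i ≢ j → a j i ≡ not (a i j)

  infix 4 _⟶_ _⟶?_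

  _⟶_ : ℕ → ℕ → Set
  i ⟶ j = a i j ≡ true

  _⟶?_ : ∀ i j → Dec (i ⟶ j)
  i ⟶? j = a i j Bool.≟ true

  ⟶⇒≢ : ∀ {i j} → i ⟶ j → i ≢ j
  ⟶⇒≢ {i} i⟶j refl with () ← trans (sym i⟶j) (irrefl i)

  ⟶-asym : ∀ {i j} → i ⟶ j → ¬ (j ⟶ i)
  ⟶-asym i⟶j j⟶i with () ← trans (sym j⟶i) (trans (anti (⟶⇒≢ i⟶j)) (cong not i⟶j))

  ⟶-flip : ∀ {i j} → i ≢ j → ¬ (i ⟶ j) → j ⟶ i
  ⟶-flip i≢j ¬i⟶j = trans (anti i≢j) (cong not (Bool.¬-not ¬i⟶j))

  ⟶-connex : ∀ {i j} → i ≢ j → i ⟶ j ⊎ j ⟶ i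
  ⟶-connex {i} {j} i≢j with i ⟶? j
  ... | yes i⟶j = inj₁ i⟶j
  ... | no ¬i⟶j = inj₂ (⟶-flip i≢j ¬i⟶j)

Outside : ℕ → ℕ → ℕ → Set
Outside a c x = x < a ⊎ c < x

outside-step : ∀ {k x} → x ≢ k → x ≢ suc k → Outside k (suc k) x
outside-step {k} {x} x≢k x≢1+k with ℕ.<-cmp x k
... | tri< x<k _ _ = inj₁ x<k
... | tri≈ _ x≡k _ = contradiction x≡k x≢k
... | tri> _ _ k<x = inj₂ (ℕ.≤∧≢⇒< k<x (x≢1+k ∘ sym))

record Rigid (n : ℕ) (a : ℕ → ℕ → Bool) : Set where
  field
    tournament : Tournament a
  open Tournament tournament public
  field
    bounded    : ∀ {i j} → i < j → i ⟶ j → j < n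
    transitive : ∀ {x y z} → x < y → y < z → x ⟶ y → y ⟶ z → x ⟶ z
    -- A vertex outside the interval from `x` to `z` lies on the same side of both. Hence each of
    -- the two paths, through `y` and through `w`, has exactly one upset, and reversing the cycle
    -- keeps the scores and the number of upsets.
    no-balanced-4-cycle : ∀ {x y z w} → x < z → Outside x z y → Outside x z w →
      x ⟶ y → y ⟶ z → z ⟶ w → w ⟶ x → ⊥
    ascent     : ∀ k → suc k ⟶ k
    drop-unique : ∀ {k x y} → k ⟶ x → x ⟶ suc k → k ⟶ y → y ⟶ suc k → x ≡ y

  Out : ℕ → Set
  Out k = ∃[ y ] k < y × k ⟶ y

  out? : ∀ k → Dec (Out k)
  out? k with ℕ.anyUpTo? (λ y → (k ℕ.<? y) ×-dec (k ⟶? y)) n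
  ... | yes (y , _ , k<y , k⟶y) = yes (y , k<y , k⟶y)
  ... | no none = no λ (y , k<y , k⟶y) → none (y , bounded k<y k⟶y , k<y , k⟶y)

  -- The vertex `x` may lie on either side. Above, it is an upset won by `k` but not by `suc k`;
  -- below, an upset lost by `suc k` but not by `k`. Either way the normalized score falls by one
  -- (`drop⇒h-suc`).
  Drop : ℕ → ℕ → Set
  Drop k x = k ⟶ x × x ⟶ suc k

  no-ascent : ∀ {k} → ¬ (k ⟶ suc k)
  no-ascent = ⟶-asym (ascent _)

  -- No vertex lies between `k` and `suc k`, so the cycle `k ⟶ x ⟶ suc k ⟶ y ⟶ k` is balanced.
  drop⇒no-gain : ∀ {k x y} → Drop k x → suc k ⟶ y → y ⟶ k → ⊥
  drop⇒no-gain {k} {x} {y} (k⟶x , x⟶1+k) 1+k⟶y y⟶k =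
    no-balanced-4-cycle (ℕ.n<1+n k)
      (outside-step (⟶⇒≢ k⟶x ∘ sym) (⟶⇒≢ x⟶1+k))
      (outside-step (⟶⇒≢ y⟶k) (⟶⇒≢ 1+k⟶y ∘ sym))
      k⟶x x⟶1+k 1+k⟶y y⟶k

  -- Together with `drop-⟶ʳ`: apart from `k` itself, the out-neighbourhood of `suc k` is that of `k`
  -- with `x` removed.
  drop-⟶ˡ : ∀ {k x y} → Drop k x → suc k ⟶ y → y ≢ k → k ⟶ y
  drop-⟶ˡ d 1+k⟶y y≢k with ⟶-connex y≢k
  ... | inj₁ y⟶k = ⊥-elim (drop⇒no-gain d 1+k⟶y y⟶k)
  ... | inj₂ k⟶y = k⟶y

  drop-⟶ʳ : ∀ {k x y} → Drop k x → k ⟶ y → y ≢ x → suc k ⟶ y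
  drop-⟶ʳ {k} {x} {y} (k⟶x , x⟶1+k) k⟶y y≢x with ⟶-connex {suc k} {y} (λ { refl → no-ascent k⟶y })
  ... | inj₁ 1+k⟶y = 1+k⟶y
  ... | inj₂ y⟶1+k = contradiction (drop-unique k⟶y y⟶1+k k⟶x x⟶1+k) y≢x

  <-suc-elim : ∀ {k y} → k < y → y ≢ suc k → suc k < y
  <-suc-elim k<y y≢1+k = ℕ.≤∧≢⇒< k<y (y≢1+k ∘ sym)

  -- The first common out-neighbour m of two twins would be a vertex that both
  -- lose at the step from m - 1 to m.
  twins⇒¬Out : ∀ {i k} → i < k →
    (∀ {y} → k < y → i ⟶ y → k ⟶ y) → (∀ {y} → k < y → k ⟶ y → i ⟶ y) → ¬ Out k
  twins⇒¬Out {i} {k} i<k i⊆k k⊆i (y , k<y , k⟶y) = none k<y k⟶y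
    where
    none : ∀ {y} → k < y → ¬ (k ⟶ y)
    none {suc y} k<1+y k⟶1+y with ℕ.m≤n⇒m<n∨m≡n (s≤s⁻¹ k<1+y)
    ... | inj₂ refl = no-ascent k⟶1+y
    ... | inj₁ k<y = ℕ.<⇒≢ i<k
      (drop-unique {y} (⟶-flip (ℕ.<⇒≢ i<y) (none k<y ∘ i⊆k k<y)) (k⊆i k<1+y k⟶1+y)
                       (⟶-flip (ℕ.<⇒≢ k<y) (none k<y)) k⟶1+y)
      where
      i<y = ℕ.<-trans i<k k<y

  dropAbove? : ∀ k → Dec (∃[ x ] x < n × suc k < x × Drop k x)
  dropAbove? k = ℕ.anyUpTo? (λ x → (suc k ℕ.<? x) ×-dec ((k ⟶? x) ×-dec (x ⟶? suc k))) n

  -- Without such a drop, every target of `k` stays a target of each later `v` and lies beyond `v`,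
  -- by induction on `v`; at `v = x₀` this is absurd.
  Out⇒Drop : ∀ {k} → Out k → ∃[ x ] suc k < x × Drop k x
  Out⇒Drop {k} (x₀ , k<x₀ , k⟶x₀) with dropAbove? k
  ... | yes (x , _ , 1+k<x , d) = x , 1+k<x , d
  ... | no none = ⊥-elim (⊆⇒⊥ (x₀ ∸ suc k) (ℕ.m+[n∸m]≡n k<x₀))
    where
    ⊆-suc : ∀ {v} → k < v → (∀ {x} → k < x → k ⟶ x → v < x × v ⟶ x) →
            ∀ {x} → k < x → k ⟶ x → suc v < x × suc v ⟶ x
    ⊆-suc {v} k<v k⊆v {x} k<x k⟶x = 1+v<x , 1+v⟶x
      where
      v<x = proj₁ (k⊆v k<x k⟶x)
      v⟶x = proj₂ (k⊆v k<x k⟶x)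
      x≢1+v : x ≢ suc v
      x≢1+v refl = no-ascent v⟶x
      1+v<x = <-suc-elim v<x x≢1+v
      1+v⟶x : suc v ⟶ x
      1+v⟶x with ⟶-connex {suc v} {x} (x≢1+v ∘ sym)
      ... | inj₁ p = p
      -- A target `x` of `k` that is lost at the step from `v` to `suc v` turns `k` and `v` into
      -- twins that still share the target `x`.
      ... | inj₂ x⟶1+v = ⊥-elim (twins⇒¬Out k<v (λ v<y k⟶y → proj₂ (k⊆v (ℕ.<-trans k<v v<y) k⟶y)) v⊆k (x , v<x , v⟶x))
        where
        v⊆k : ∀ {y} → v < y → v ⟶ y → k ⟶ y
        v⊆k {y} v<y v⟶y with ⟶-connex (ℕ.<⇒≢ (ℕ.<-trans k<v v<y))
        ... | inj₁ k⟶y = k⟶y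
        -- A target `y` of `v` that `k` does not beat closes the cycle `k ⟶ x ⟶ suc v ⟶ y ⟶ k`,
        -- which is balanced because `x` and `y` both lie above `suc v`.
        ... | inj₂ y⟶k = ⊥-elim (no-balanced-4-cycle (ℕ.m≤n⇒m≤1+n k<v)
                (inj₂ 1+v<x) (inj₂ (<-suc-elim v<y (λ { refl → no-ascent v⟶y })))
                k⟶x x⟶1+v (drop-⟶ʳ (v⟶x , x⟶1+v) v⟶y (λ { refl → ⟶-asym k⟶x y⟶k })) y⟶k)

    ⊆-all : ∀ d {x} → k < x → k ⟶ x → suc k + d < x × suc k + d ⟶ x
    ⊆-all zero {x} k<x k⟶x rewrite ℕ.+-identityʳ k =
      let 1+k<x = <-suc-elim k<x (λ { refl → no-ascent k⟶x }) in
      1+k<x , ⟶-flip (ℕ.<⇒≢ 1+k<x ∘ sym) λ x⟶1+k → none (x , bounded k<x k⟶x , 1+k<x , k⟶x , x⟶1+k)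
    ⊆-all (suc d) k<x k⟶x rewrite ℕ.+-suc k d = ⊆-suc (s≤s (ℕ.m≤m+n k d)) (⊆-all d) k<x k⟶x

    ⊆⇒⊥ : ∀ d → suc k + d ≡ x₀ → ⊥
    ⊆⇒⊥ d eq = ℕ.<⇒≢ (proj₁ (⊆-all d k<x₀ k⟶x₀)) eq

  record LastOut (k : ℕ) : Set where
    field
      last target : ℕ
      k≤last      : k ≤ last
      run         : ∀ {j} → k ≤ j → j ≤ last → Out j
      last<target : last < target
      last⟶target : last ⟶ target
      only-target : ∀ {y} → last < y → last ⟶ y → y ≡ target

  -- A vertex that wins an upset lies below `n`, so the run ends; `d` is the fuel for reaching its
  -- end. There every target other than the dropped one would pass on to `suc k`, which has none, so
  -- a single target is left.
  lastOut : ∀ {k} → Out k → LastOut k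
  lastOut {k} o = go (n ∸ k) (ℕ.≤-reflexive (sym (ℕ.m+[n∸m]≡n (ℕ.<⇒≤ (k<n o))))) o
    where
    k<n : ∀ {k} → Out k → k < n
    k<n (y , k<y , k⟶y) = ℕ.<-trans k<y (bounded k<y k⟶y)

    go : ∀ d {k} → n ≤ k + d → Out k → LastOut k
    go zero {k} n≤k o rewrite ℕ.+-identityʳ k = contradiction (k<n o) (ℕ.≤⇒≯ n≤k)
    go (suc d) {k} n≤k+1+d o with Out⇒Drop o | out? (suc k)
    ... | x , 1+k<x , drop | no ¬o = record
      { last = k ; target = x ; k≤last = ℕ.≤-refl
      ; run = λ k≤j j≤k → subst Out (ℕ.≤-antisym k≤j j≤k) o
      ; last<target = ℕ.<-trans (ℕ.n<1+n k) 1+k<x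
      ; last⟶target = proj₁ drop
      ; only-target = only }
      where
      only : ∀ {y} → k < y → k ⟶ y → y ≡ x
      only {y} k<y k⟶y with y ℕ.≟ x
      ... | yes y≡x = y≡x
      ... | no y≢x = contradiction
        (y , <-suc-elim k<y (λ { refl → no-ascent k⟶y }) , drop-⟶ʳ drop k⟶y y≢x) ¬o
    ... | _ | yes o′ = record
      { last = last ; target = target ; k≤last = ℕ.<⇒≤ k≤last
      ; run = λ {j} k≤j j≤last → case ℕ.m≤n⇒m<n∨m≡n k≤j of λ where
          (inj₁ k<j) → run k<j j≤last
          (inj₂ refl) → o
      ; last<target = last<target ; last⟶target = last⟶target
      ; only-target = only-target }
      where
      open LastOut (go d (subst (n ≤_) (ℕ.+-suc k d) n≤k+1+d) o′)

  Uncrossed : ℕ → Set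
  Uncrossed s = ∀ {x y} → x < s → s ≤ y → ¬ (x ⟶ y)

  Neutral : ℕ → Set
  Neutral k = (∀ {y} → y < k → ¬ (y ⟶ k)) × ¬ Out k

  -- A symmetric segment with p = `suc height`: its positive entries are at `s` to `last`, its
  -- negative ones at `first-sink` to `height + first-sink`, and `gap` leaves at least one zero
  -- between them. The field `sinks` starts one vertex before `first-sink`, so that it covers the
  -- step from 0 to -1.
  record Block (s : ℕ) : Set where
    field
      last first-sink height : ℕ
      last≡      : height + s ≡ last
      gap        : suc last < first-sink
      inside     : height + first-sink < n
      sources    : ∀ {k} → s ≤ k → k ≤ last → ∃[ x ] Drop k x
      neutral    : ∀ {k} → last < k → k < first-sink → Neutral k
      sinks      : ∀ {k} → first-sink ≤ suc k → k < height + first-sink → ∃[ x ] Drop k x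
      uncrossed  : Uncrossed (suc (height + first-sink))

  -- The block that starts with a run of sources

  module _ {s : ℕ} (uncrossed-s : Uncrossed s) (runFrom-s : LastOut s) where

    open LastOut runFrom-s

    -- By transitivity an upset of the target would be a second upset of `last`.
    target-¬Out : ¬ Out target
    target-¬Out (y , m<y , m⟶y) = ℕ.<⇒≢ m<y (sym (only-target (ℕ.<-trans last<target m<y)
      (transitive last<target m<y last⟶target m⟶y)))

    -- Otherwise let i′ be the end of the run of a source in between: its
    -- target m′ differs from m, as twins have no targets, and then the cycle
    -- last ⟶ m ⟶ i′ ⟶ m′ ⟶ last is balanced.
    no-source-between : ∀ {k} → last < k → k < target → ¬ Out k
    no-source-between {k} i<k k<m out-k = main
      where
      open LastOut (lastOut out-k) renaming
        ( last to i′; target to m′; k≤last to k≤i′; run to run′; last<target to i′<m′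
        ; last⟶target to i′⟶m′; only-target to only-m′)
      i<i′ = ℕ.<-≤-trans i<k k≤i′
      i′<m : i′ < target
      i′<m = ℕ.≰⇒> λ m≤i′ → target-¬Out (run′ (ℕ.<⇒≤ k<m) m≤i′)
      main : ⊥
      main with m′ ℕ.≟ target
      ... | yes m′≡m = twins⇒¬Out i<i′
              (λ i′<y i⟶y → subst (i′ ⟶_) (trans m′≡m (sym (only-target (ℕ.<-trans i<i′ i′<y) i⟶y))) i′⟶m′)
              (λ i′<y i′⟶y → subst (last ⟶_) (trans (sym m′≡m) (sym (only-m′ i′<y i′⟶y))) last⟶target)
              (m′ , i′<m′ , i′⟶m′)
      ... | no m′≢m = no-balanced-4-cycle i<i′ (inj₂ i′<m) (inj₂ i′<m′) last⟶target
              (⟶-flip (ℕ.<⇒≢ i′<m) λ i′⟶m → m′≢m (sym (only-m′ i′<m i′⟶m)))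
              i′⟶m′
              (⟶-flip (ℕ.<⇒≢ i<m′) λ i⟶m′ → m′≢m (only-target i<m′ i⟶m′))
        where
        i<m′ = ℕ.<-trans i<i′ i′<m′

    source-drop : ∀ {u} → s ≤ u → u ≤ last → ∃[ x ] suc u < x × Drop u x
    source-drop s≤u u≤i = Out⇒Drop (run s≤u u≤i)

    -- An upset newly lost at the step from `u` to `suc u` would be a second drop of the source `u`,
    -- next to the one above `suc u` that `source-drop` provides. At `s` itself the uncrossed cut
    -- excludes it.
    source-no-in : ∀ {u} → s ≤ u → u ≤ suc last → ∀ {y} → y < u → ¬ (y ⟶ u)
    source-no-in {suc u} s≤1+u 1+u≤1+i {y} y<1+u y⟶1+u with ℕ.m≤n⇒m<n∨m≡n s≤1+u
    ... | inj₂ refl = uncrossed-s y<1+u ℕ.≤-refl y⟶1+u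
    ... | inj₁ s<1+u with source-drop (s≤s⁻¹ s<1+u) (s≤s⁻¹ 1+u≤1+i)
    ...   | x , 1+u<x , u⟶x , x⟶1+u with ℕ.m≤n⇒m<n∨m≡n (s≤s⁻¹ y<1+u)
    ...     | inj₂ refl = no-ascent y⟶1+u
    ...     | inj₁ y<u with u ⟶? y
    ...       | no ¬u⟶y = source-no-in (s≤s⁻¹ s<1+u) (ℕ.<⇒≤ 1+u≤1+i) y<u (⟶-flip (ℕ.<⇒≢ y<u ∘ sym) ¬u⟶y)
    ...       | yes u⟶y = ℕ.<⇒≢ (ℕ.<-trans y<1+u 1+u<x) (drop-unique u⟶y y⟶1+u u⟶x x⟶1+u)

    out-antitone : ∀ {u w y} → s ≤ u → u ≤ w → w ≤ last → w < y → w ⟶ y → u ⟶ y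
    out-antitone {u} {w} s≤u u≤w w≤i w<y w⟶y with ℕ.m≤n⇒m<n∨m≡n u≤w
    ... | inj₂ refl = w⟶y
    out-antitone {u} {suc w} s≤u u≤1+w 1+w≤i 1+w<y 1+w⟶y | inj₁ u<1+w =
      out-antitone s≤u u≤w (ℕ.<⇒≤ 1+w≤i) w<y
        (drop-⟶ˡ (proj₂ (proj₂ (source-drop (ℕ.≤-trans s≤u u≤w) (ℕ.<⇒≤ 1+w≤i)))) 1+w⟶y (ℕ.<⇒≢ w<y ∘ sym))
      where
      u≤w = s≤s⁻¹ u<1+w
      w<y = ℕ.<-trans (ℕ.n<1+n w) 1+w<y

    -- The upsets between sources and sinks form a staircase, and `(u , v)` is one of its corners:
    -- the targets of `u` form the interval from `v` to `target`, and the upsets lost by `v` come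
    -- from the interval from `s` to `u`. The field `sinks` collects the drops met on the way from
    -- `target` back to `v`.
    record Corner (u v : ℕ) : Set where
      field
        u<v    : u < v
        v≤m    : v ≤ target
        out→   : ∀ {y} → u < y → u ⟶ y → v ≤ y × y ≤ target
        out←   : ∀ {y} → v ≤ y → y ≤ target → u ⟶ y
        in→    : ∀ {x} → x < v → x ⟶ v → s ≤ x × x ≤ u
        in←    : ∀ {x} → s ≤ x → x ≤ u → x ⟶ v
        sinks  : ∀ {k} → v ≤ k → k < target → ∃[ x ] Drop k x

    corner-last : Corner last target
    corner-last = record
      { u<v = last<target
      ; v≤m = ℕ.≤-refl
      ; out→ = λ i<y i⟶y → let y≡m = only-target i<y i⟶y in ℕ.≤-reflexive (sym y≡m) , ℕ.≤-reflexive y≡m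
      ; out← = λ m≤y y≤m → subst (last ⟶_) (ℕ.≤-antisym m≤y y≤m) last⟶target
      ; in→ = λ x<m x⟶m →
          ℕ.≮⇒≥ (λ x<s → uncrossed-s x<s (ℕ.≤-trans k≤last (ℕ.<⇒≤ last<target)) x⟶m) ,
          ℕ.≮⇒≥ (λ i<x → no-source-between i<x x<m (target , x<m , x⟶m))
      ; in← = λ s≤x x≤i → out-antitone s≤x x≤i ℕ.≤-refl last<target last⟶target
      ; sinks = λ m≤k k<m → contradiction k<m (ℕ.≤⇒≯ m≤k)
      }

    -- The targets of `suc u` start at `suc v`, so `v` beats `suc u` while `suc v` loses to it. As
    -- this is the only drop at `v`, the upsets lost by `v` are those lost by `suc v` without the
    -- one from `suc u`. Hence `u` beats `v` but `suc u` does not, and this drop in turn adds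
    -- exactly `v` to the targets of `suc u`.
    corner-pred : ∀ {u v} → s ≤ u → Corner (suc u) (suc v) → Corner u v
    corner-pred {u} {v} s≤u c = record
      { u<v = u<v
      ; v≤m = ℕ.<⇒≤ C.v≤m
      ; out→ = λ {y} → out→ {y}
      ; out← = λ {y} → out← {y}
      ; in→ = in→
      ; in← = in←
      ; sinks = sinks
      }
      where
      module C = Corner c
      u<v = s≤s⁻¹ C.u<v
      1+u⟶1+v = C.in← (ℕ.m≤n⇒m≤1+n s≤u) ℕ.≤-refl
      1+u<v : suc u < v
      1+u<v = ℕ.≤∧≢⇒< u<v λ { refl → no-ascent 1+u⟶1+v }
      v⟶1+u : v ⟶ suc u
      v⟶1+u = ⟶-flip (ℕ.<⇒≢ 1+u<v) λ 1+u⟶v → ℕ.<-irrefl refl (proj₁ (C.out→ 1+u<v 1+u⟶v))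
      drop-v : Drop v (suc u)
      drop-v = v⟶1+u , 1+u⟶1+v

      in→ : ∀ {x} → x < v → x ⟶ v → s ≤ x × x ≤ u
      in→ {x} x<v x⟶v with ⟶-connex (ℕ.<⇒≢ (ℕ.m≤n⇒m≤1+n x<v))
      ... | inj₂ 1+v⟶x = ⊥-elim (drop⇒no-gain drop-v 1+v⟶x x⟶v)
      ... | inj₁ x⟶1+v with C.in→ (ℕ.m≤n⇒m≤1+n x<v) x⟶1+v
      ...   | s≤x , x≤1+u = s≤x , s≤s⁻¹ (ℕ.≤∧≢⇒< x≤1+u λ { refl → ⟶-asym v⟶1+u x⟶v })

      in← : ∀ {x} → s ≤ x → x ≤ u → x ⟶ v
      in← {x} s≤x x≤u with ⟶-connex (ℕ.<⇒≢ (ℕ.≤-<-trans x≤u u<v))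
      ... | inj₁ x⟶v = x⟶v
      ... | inj₂ v⟶x = contradiction
        (drop-unique v⟶x (C.in← s≤x (ℕ.m≤n⇒m≤1+n x≤u)) v⟶1+u 1+u⟶1+v) (ℕ.<⇒≢ (s≤s x≤u))

      drop-u : Drop u v
      drop-u = in← s≤u ℕ.≤-refl , v⟶1+u

      out→ : ∀ {y} → u < y → u ⟶ y → v ≤ y × y ≤ target
      out→ {y} u<y u⟶y with y ℕ.≟ v
      ... | yes refl = ℕ.≤-refl , ℕ.<⇒≤ C.v≤m
      ... | no y≢v with C.out→ (<-suc-elim u<y λ { refl → no-ascent u⟶y }) (drop-⟶ʳ drop-u u⟶y y≢v)
      ...   | v<y , y≤m = ℕ.<⇒≤ v<y , y≤m

      out← : ∀ {y} → v ≤ y → y ≤ target → u ⟶ y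
      out← v≤y y≤m with ℕ.m≤n⇒m<n∨m≡n v≤y
      ... | inj₂ refl = proj₁ drop-u
      ... | inj₁ v<y = drop-⟶ˡ drop-u (C.out← v<y y≤m) (ℕ.<⇒≢ (ℕ.<-trans u<v v<y) ∘ sym)

      sinks : ∀ {k} → v ≤ k → k < target → ∃[ x ] Drop k x
      sinks v≤k k<m with ℕ.m≤n⇒m<n∨m≡n v≤k
      ... | inj₂ refl = suc u , drop-v
      ... | inj₁ v<k = C.sinks v<k k<m

    -- Both coordinates move in step, so a run of `suc e` sources faces equally many sinks. This is
    -- why the positive and the negative part of a segment have the same length.
    corner-start : ∀ e {v} → Corner (e + s) v → ∃[ v₀ ] e + v₀ ≡ v × Corner s v₀
    corner-start zero c = _ , refl , c
    corner-start (suc e) {zero} c with () ← Corner.u<v c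
    corner-start (suc e) {suc v} c with corner-start e (corner-pred (ℕ.m≤n+m s e) c)
    ... | v₀ , eq , c₀ = v₀ , cong suc eq , c₀

    block : Block s
    block with corner-start (last ∸ s) (subst (λ i → Corner i target) (sym (ℕ.m∸n+n≡m k≤last)) corner-last)
    ... | v , eq , c = record
      { last = last ; first-sink = v ; height = last ∸ s
      ; last≡ = ℕ.m∸n+n≡m k≤last
      ; gap = gap
      ; inside = subst (_< n) (sym eq) (bounded last<target last⟶target)
      ; sources = λ s≤k k≤i → let x , _ , d = source-drop s≤k k≤i in x , d
      ; neutral = neutral
      ; sinks = sinks
      ; uncrossed = subst (Uncrossed ∘ suc) (sym eq) uncrossed
      }
      where
      open Corner c renaming (sinks to later-sinks)
      s⟶v = out← ℕ.≤-refl v≤m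

      -- `source-no-in` extends to `suc last`, one beyond the last source; this keeps at least one
      -- zero in the middle.
      gap : suc last < v
      gap = ℕ.≰⇒> λ v≤1+i → source-no-in (ℕ.<⇒≤ u<v) v≤1+i u<v s⟶v

      from-sources : ∀ {x y} → x < y → x ⟶ y → s ≤ y → x < target → s ≤ x × x ≤ last
      from-sources {x} x<y x⟶y s≤y x<m =
        ℕ.≮⇒≥ (λ x<s → uncrossed-s x<s s≤y x⟶y) ,
        ℕ.≮⇒≥ (λ i<x → no-source-between i<x x<m (_ , x<y , x⟶y))

      range : ∀ {x y} → x < y → x ⟶ y → s ≤ x → x ≤ last → v ≤ y × y ≤ target
      range x<y x⟶y s≤x x≤i =
        out→ (ℕ.≤-<-trans s≤x x<y) (out-antitone ℕ.≤-refl s≤x x≤i x<y x⟶y)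

      neutral : ∀ {k} → last < k → k < v → Neutral k
      neutral i<k k<v =
        (λ y<k y⟶k → let s≤y , y≤i = from-sources y<k y⟶k (ℕ.≤-trans k≤last (ℕ.<⇒≤ i<k)) (ℕ.<-trans y<k k<m)
                     in ℕ.<⇒≱ k<v (proj₁ (range y<k y⟶k s≤y y≤i))) ,
        no-source-between i<k k<m
        where
        k<m = ℕ.<-≤-trans k<v v≤m

      sinks : ∀ {k} → v ≤ suc k → k < (last ∸ s) + v → ∃[ x ] Drop k x
      sinks {k} v≤1+k k<m′ with ℕ.m≤n⇒m<n∨m≡n v≤1+k
      ... | inj₁ v<1+k = later-sinks (s≤s⁻¹ v<1+k) (subst (k <_) eq k<m′)
      -- Here `k` is the last neutral vertex. It beats `s`, whose targets start at `suc k`, and the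
      -- first sink `suc k` loses to `s`.
      ... | inj₂ refl = s , ⟶-flip (ℕ.<⇒≢ s<k) (λ s⟶k → ℕ.<-irrefl refl (proj₁ (out→ s<k s⟶k))) , s⟶v
        where
        s<k = ℕ.≤-<-trans k≤last (s≤s⁻¹ gap)

      uncrossed : Uncrossed (suc target)
      uncrossed {x} {y} x<1+m m<y x⟶y with ℕ.m≤n⇒m<n∨m≡n (s≤s⁻¹ x<1+m)
      ... | inj₂ refl = target-¬Out (y , m<y , x⟶y)
      ... | inj₁ x<m with from-sources (ℕ.<-trans x<m m<y) x⟶y (ℕ.<⇒≤ (ℕ.≤-<-trans k≤last (ℕ.<-trans last<target m<y))) x<m
      ...   | s≤x , x≤i = ℕ.<⇒≱ m<y (proj₂ (range (ℕ.<-trans x<m m<y) x⟶y s≤x x≤i))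

-- Sums and arc reversals

<ᵇ-yes : ∀ {i j} → i < j → (i <ᵇ j) ≡ true
<ᵇ-yes {i} {j} = dec-true (i ℕ.<? j)

<ᵇ-no : ∀ {i j} → ¬ (i < j) → (i <ᵇ j) ≡ false
<ᵇ-no {i} {j} = dec-false (i ℕ.<? j)

<⇒0<- : ∀ {i j} → i <ᶻ j → 0ℤ <ᶻ j -ᶻ i
<⇒0<- {i} {j} i<j = subst (_<ᶻ j -ᶻ i) (ℤ.+-inverseʳ i) (ℤ.+-monoˡ-< (-ᶻ i) i<j)

<-gap : ∀ {x y} k → y ≡ x +ᶻ +[1+ k ] → x <ᶻ y
<-gap {x} k refl = subst (_<ᶻ x +ᶻ +[1+ k ]) (ℤ.+-identityʳ x) (ℤ.+-monoʳ-< x (ℤ.+<+ (s≤s z≤n)))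

∑ : ℕ → (ℕ → ℤ) → ℤ
∑ zero    f = 0ℤ
∑ (suc n) f = f 0 +ᶻ ∑ n (f ∘ suc)

∑-cong : ∀ {n f g} → (∀ {i} → i < n → f i ≡ g i) → ∑ n f ≡ ∑ n g
∑-cong {zero}  f≡g = refl
∑-cong {suc n} f≡g = cong₂ _+ᶻ_ (f≡g (s≤s z≤n)) (∑-cong (f≡g ∘ s≤s))

∑-+ : ∀ n f g → ∑ n (λ i → f i +ᶻ g i) ≡ ∑ n f +ᶻ ∑ n g
∑-+ zero f g = refl
∑-+ (suc n) f g rewrite ∑-+ n (f ∘ suc) (g ∘ suc) = eq (f 0) (g 0) _ _
  where
  eq : ∀ a b c d → (a +ᶻ b) +ᶻ (c +ᶻ d) ≡ (a +ᶻ c) +ᶻ (b +ᶻ d)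
  eq = solve-∀

∑-*ˡ : ∀ n c f → ∑ n (λ i → c *ᶻ f i) ≡ c *ᶻ ∑ n f
∑-*ˡ zero c f = sym (ℤ.*-zeroʳ c)
∑-*ˡ (suc n) c f rewrite ∑-*ˡ n c (f ∘ suc) = sym (ℤ.*-distribˡ-+ c (f 0) _)

∑-neg : ∀ n f → ∑ n (λ i → -ᶻ f i) ≡ -ᶻ ∑ n f
∑-neg zero f = refl
∑-neg (suc n) f rewrite ∑-neg n (f ∘ suc) = sym (ℤ.neg-distrib-+ (f 0) _)

∑-- : ∀ n f g → ∑ n (λ i → f i -ᶻ g i) ≡ ∑ n f -ᶻ ∑ n g
∑-- n f g = trans (∑-+ n f (λ i → -ᶻ g i)) (cong (∑ n f +ᶻ_) (∑-neg n g))

∑-mono : ∀ n {f g} → (∀ {i} → i < n → f i ≤ᶻ g i) → ∑ n f ≤ᶻ ∑ n g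
∑-mono zero f≤g = ℤ.≤-refl
∑-mono (suc n) f≤g = ℤ.+-mono-≤ (f≤g (s≤s z≤n)) (∑-mono n (f≤g ∘ s≤s))

∑-zero : ∀ n → ∑ n (λ _ → 0ℤ) ≡ 0ℤ
∑-zero zero = refl
∑-zero (suc n) = trans (ℤ.+-identityˡ _) (∑-zero n)

∑-swap : ∀ m n (f : ℕ → ℕ → ℤ) → ∑ m (λ i → ∑ n (f i)) ≡ ∑ n (λ j → ∑ m (λ i → f i j))
∑-swap zero n f = sym (∑-zero n)
∑-swap (suc m) n f = trans (cong (∑ n (f 0) +ᶻ_) (∑-swap m n (f ∘ suc))) (sym (∑-+ n (f 0) _))

∑-nonneg : ∀ n {f} → (∀ {i} → i < n → 0ℤ ≤ᶻ f i) → 0ℤ ≤ᶻ ∑ n f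
∑-nonneg n {f} 0≤f = subst (_≤ᶻ ∑ n f) (∑-zero n) (∑-mono n 0≤f)

∑-nonneg⇒≤0 : ∀ n {f} → (∀ {i} → i < n → 0ℤ ≤ᶻ f i) → ∑ n f ≤ᶻ 0ℤ → ∀ {i} → i < n → f i ≤ᶻ 0ℤ
∑-nonneg⇒≤0 (suc n) {f} 0≤f ∑≤0 {zero} _ =
  ℤ.≤-trans (subst (_≤ᶻ f 0 +ᶻ ∑ n (f ∘ suc)) (ℤ.+-identityʳ (f 0)) (ℤ.+-monoʳ-≤ (f 0) (∑-nonneg n {f ∘ suc} (0≤f ∘ s≤s)))) ∑≤0
∑-nonneg⇒≤0 (suc n) {f} 0≤f ∑≤0 {suc i} i<n =
  ∑-nonneg⇒≤0 n {f ∘ suc} (0≤f ∘ s≤s)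
    (ℤ.≤-trans (subst (_≤ᶻ f 0 +ᶻ ∑ n (f ∘ suc)) (ℤ.+-identityˡ (∑ n (f ∘ suc))) (ℤ.+-monoˡ-≤ (∑ n (f ∘ suc)) (0≤f {0} (s≤s z≤n)))) ∑≤0)
    (s≤s⁻¹ i<n)

∑-1 : ∀ n → ∑ n (λ _ → 1ℤ) ≡ + n
∑-1 zero    = refl
∑-1 (suc n) = cong (1ℤ +ᶻ_) (∑-1 n)

∑-split : ∀ m n f → ∑ (m + n) f ≡ ∑ m f +ᶻ ∑ n (λ i → f (m + i))
∑-split zero    n f = sym (ℤ.+-identityˡ _)
∑-split (suc m) n f = trans (cong (f 0 +ᶻ_) (∑-split m n (f ∘ suc))) (sym (ℤ.+-assoc (f 0) _ _))

ι : Bool → ℤ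
ι true  = 1ℤ
ι false = 0ℤ

δ : ℕ → ℕ → ℤ
δ x i = ι (does (x ℕ.≟ i))

δ-refl : ∀ x → δ x x ≡ 1ℤ
δ-refl x = cong ι (dec-true (x ℕ.≟ x) refl)

δ-≢ : ∀ {x i} → x ≢ i → δ x i ≡ 0ℤ
δ-≢ {x} {i} x≢i = cong ι (dec-false (x ℕ.≟ i) x≢i)

∑-δ : ∀ {n x} → x < n → ∀ (f : ℕ → ℤ) → ∑ n (λ i → δ x i *ᶻ f i) ≡ f x
∑-δ {suc n} {zero} _ f
  rewrite ∑-zero n = trans (ℤ.+-identityʳ _) (ℤ.*-identityˡ _)
∑-δ {suc n} {suc x} x<n f = trans (ℤ.+-identityˡ _) (∑-δ {n} {x} (s≤s⁻¹ x<n) (f ∘ suc))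

∑-δ-1 : ∀ {n x} → x < n → ∑ n (δ x) ≡ 1ℤ
∑-δ-1 {n} {x} x<n = trans (∑-cong {n} (λ _ → sym (ℤ.*-identityʳ _))) (∑-δ {n} x<n (λ _ → 1ℤ))

score : ℕ → (ℕ → ℕ → Bool) → ℕ → ℤ
score n a i = ∑ n (λ j → ι (a i j))

-- As a weight on pairs it singles out upsets; as a function of the first argument alone it is the
-- indicator of an initial segment, summed by `∑-χ`.
χ : ℕ → ℕ → ℤ
χ i j = ι (i <ᵇ j)

χ-yes : ∀ {i j} → i < j → χ i j ≡ 1ℤ
χ-yes i<j = cong ι (<ᵇ-yes i<j)

χ-no : ∀ {i j} → ¬ (i < j) → χ i j ≡ 0ℤ
χ-no i≮j = cong ι (<ᵇ-no i≮j)

∑-χ : ∀ {n k} → k ≤ n → ∑ n (λ j → χ j k) ≡ + k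
∑-χ {n} {zero} _ = ∑-zero n
∑-χ {suc n} {suc k} k≤n = cong (1ℤ +ᶻ_) (∑-χ {n} {k} (s≤s⁻¹ k≤n))

∑-χ-full : ∀ {n k} → n ≤ k → ∑ n (λ j → χ j k) ≡ + n
∑-χ-full {zero} _ = refl
∑-χ-full {suc n} {suc k} n≤k = cong (1ℤ +ᶻ_) (∑-χ-full {n} {k} (s≤s⁻¹ n≤k))

upsetSum : ℕ → (ℕ → ℕ → Bool) → ℤ
upsetSum n a = ∑ n (λ i → ∑ n (λ j → χ i j *ᶻ ι (a i j)))

≡ᵇ-true : ∀ {x i} → (x ≡ᵇ i) ≡ true → x ≡ i
≡ᵇ-true {x} {i} eq = ℕ.≡ᵇ⇒≡ x i (subst T (sym eq) _)

sameArc : ℕ → ℕ → ℕ → ℕ → Bool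
sameArc x y i j = does (x ℕ.≟ i) ∧ does (y ℕ.≟ j)

-- Cycles are reversed one arc at a time: each reversal moves one point from its tail to its head,
-- and these changes cancel around the cycle.
reverseArc : ℕ → ℕ → (ℕ → ℕ → Bool) → (ℕ → ℕ → Bool)
reverseArc x y a i j = a i j xor (sameArc x y i j ∨ sameArc y x i j)

module _ {a : ℕ → ℕ → Bool} (tournament : Tournament a) where
  open Tournament tournament

  reverseArc-tournament : ∀ {x y} → x ≢ y → Tournament (reverseArc x y a)
  reverseArc-tournament {x} {y} x≢y = record { irrefl = irrefl′ ; anti = anti′ }
    where
    irrefl′ : ∀ i → reverseArc x y a i i ≡ false
    irrefl′ i with x ≡ᵇ i in x≡i | y ≡ᵇ i in y≡i
    ... | true  | true  = contradiction (trans (≡ᵇ-true x≡i) (sym (≡ᵇ-true y≡i))) x≢y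
    ... | true  | false = trans (Bool.xor-identityʳ _) (irrefl i)
    ... | false | true  = trans (Bool.xor-identityʳ _) (irrefl i)
    ... | false | false = trans (Bool.xor-identityʳ _) (irrefl i)

    not-xor : ∀ b c → not b xor c ≡ not (b xor c)
    not-xor false c = refl
    not-xor true c = sym (Bool.not-involutive c)

    anti′ : ∀ {i j} → i ≢ j → reverseArc x y a j i ≡ not (reverseArc x y a i j)
    anti′ {i} {j} i≢j rewrite anti i≢j
      | Bool.∨-comm (sameArc x y j i) (sameArc y x j i)
      | Bool.∧-comm (does (y ℕ.≟ j)) (does (x ℕ.≟ i))
      | Bool.∧-comm (does (x ℕ.≟ j)) (does (y ℕ.≟ i)) = not-xor (a i j) _

  unchanged : ∀ b → ι (b xor false) ≡ ι b -ᶻ 0ℤ +ᶻ 0ℤ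
  unchanged false = refl
  unchanged true = refl

  ι-reverseArc : ∀ {x y} → x ⟶ y → ∀ i j →
    ι (reverseArc x y a i j) ≡ ι (a i j) -ᶻ δ x i *ᶻ δ y j +ᶻ δ y i *ᶻ δ x j
  ι-reverseArc {x} {y} x⟶y i j
    with x ≡ᵇ i in x≡i | y ≡ᵇ j in y≡j | y ≡ᵇ i in y≡i | x ≡ᵇ j in x≡j
  ... | true | _ | true | _ = contradiction (trans (≡ᵇ-true x≡i) (sym (≡ᵇ-true y≡i))) (⟶⇒≢ x⟶y)
  ... | _ | true | _ | true = contradiction (trans (≡ᵇ-true x≡j) (sym (≡ᵇ-true y≡j))) (⟶⇒≢ x⟶y)
  ... | true | true | false | false
    rewrite subst₂ _⟶_ (≡ᵇ-true x≡i) (≡ᵇ-true y≡j) x⟶y = refl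
  ... | false | false | true | true
    rewrite trans (sym (cong₂ a (≡ᵇ-true y≡i) (≡ᵇ-true x≡j))) (trans (anti (⟶⇒≢ x⟶y)) (cong not x⟶y)) = refl
  ... | true | false | false | _ = unchanged (a i j)
  ... | false | true | true | false = unchanged (a i j)
  ... | false | _ | false | _ = unchanged (a i j)
  ... | false | false | true | false = unchanged (a i j)

  -- The weight `v` makes one computation serve twice: constantly 1 it gives scores, and as `χ i` it
  -- gives upsets.
  reverseArc-row : ∀ {n x y} → x < n → y < n → x ⟶ y → ∀ (v : ℕ → ℤ) i →
    ∑ n (λ j → v j *ᶻ ι (reverseArc x y a i j))
      ≡ ∑ n (λ j → v j *ᶻ ι (a i j)) -ᶻ δ x i *ᶻ v y +ᶻ δ y i *ᶻ v x
  reverseArc-row {n} {x} {y} x<n y<n x⟶y v i = begin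
    ∑ n (λ j → v j *ᶻ ι (reverseArc x y a i j))
      ≡⟨ ∑-cong {n} (λ {j} _ → trans (cong (v j *ᶻ_) (ι-reverseArc x⟶y i j)) (eq (v j) _ (δ x i) (δ y j) (δ y i) (δ x j))) ⟩
    ∑ n (λ j → (v j *ᶻ ι (a i j) -ᶻ δ x i *ᶻ (δ y j *ᶻ v j)) +ᶻ δ y i *ᶻ (δ x j *ᶻ v j))
      ≡⟨ ∑-+ n _ _ ⟩
    ∑ n (λ j → v j *ᶻ ι (a i j) -ᶻ δ x i *ᶻ (δ y j *ᶻ v j)) +ᶻ ∑ n (λ j → δ y i *ᶻ (δ x j *ᶻ v j))
      ≡⟨ cong₂ _+ᶻ_ (∑-- n _ _) (trans (∑-*ˡ n (δ y i) _) (cong (δ y i *ᶻ_) (∑-δ x<n v))) ⟩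
    (∑ n (λ j → v j *ᶻ ι (a i j)) -ᶻ ∑ n (λ j → δ x i *ᶻ (δ y j *ᶻ v j))) +ᶻ δ y i *ᶻ v x
      ≡⟨ cong (λ z → (∑ n (λ j → v j *ᶻ ι (a i j)) -ᶻ z) +ᶻ δ y i *ᶻ v x) (trans (∑-*ˡ n (δ x i) _) (cong (δ x i *ᶻ_) (∑-δ y<n v))) ⟩
    ∑ n (λ j → v j *ᶻ ι (a i j)) -ᶻ δ x i *ᶻ v y +ᶻ δ y i *ᶻ v x ∎
    where
    open ≡-Reasoning
    eq : ∀ v a p q r s → v *ᶻ (a -ᶻ p *ᶻ q +ᶻ r *ᶻ s) ≡ (v *ᶻ a -ᶻ p *ᶻ (q *ᶻ v)) +ᶻ r *ᶻ (s *ᶻ v)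
    eq = solve-∀

  reverseArc-score : ∀ {n x y} → x < n → y < n → x ⟶ y → ∀ i →
    score n (reverseArc x y a) i ≡ score n a i -ᶻ δ x i +ᶻ δ y i
  reverseArc-score {n} {x} {y} x<n y<n x⟶y i = begin
    score n (reverseArc x y a) i
      ≡⟨ ∑-cong {n} (λ _ → sym (ℤ.*-identityˡ _)) ⟩
    ∑ n (λ j → 1ℤ *ᶻ ι (reverseArc x y a i j))
      ≡⟨ reverseArc-row {n} x<n y<n x⟶y (λ _ → 1ℤ) i ⟩
    ∑ n (λ j → 1ℤ *ᶻ ι (a i j)) -ᶻ δ x i *ᶻ 1ℤ +ᶻ δ y i *ᶻ 1ℤ
      ≡⟨ cong₂ _+ᶻ_ (cong₂ _-ᶻ_ (∑-cong {n} (λ _ → ℤ.*-identityˡ _)) (ℤ.*-identityʳ (δ x i))) (ℤ.*-identityʳ (δ y i)) ⟩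
    score n a i -ᶻ δ x i +ᶻ δ y i ∎
    where open ≡-Reasoning

  reverseArc-upsetSum : ∀ {n x y} → x < n → y < n → x ⟶ y →
    upsetSum n (reverseArc x y a) ≡ upsetSum n a -ᶻ χ x y +ᶻ χ y x
  reverseArc-upsetSum {n} {x} {y} x<n y<n x⟶y = begin
    upsetSum n (reverseArc x y a)
      ≡⟨ ∑-cong {n} (λ {i} _ → reverseArc-row {n} x<n y<n x⟶y (χ i) i) ⟩
    ∑ n (λ i → (∑ n (λ j → χ i j *ᶻ ι (a i j)) -ᶻ δ x i *ᶻ χ i y) +ᶻ δ y i *ᶻ χ i x)
      ≡⟨ ∑-+ n _ _ ⟩
    ∑ n (λ i → ∑ n (λ j → χ i j *ᶻ ι (a i j)) -ᶻ δ x i *ᶻ χ i y) +ᶻ ∑ n (λ i → δ y i *ᶻ χ i x)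
      ≡⟨ cong₂ _+ᶻ_ (∑-- n _ _) (∑-δ y<n (λ i → χ i x)) ⟩
    (upsetSum n a -ᶻ ∑ n (λ i → δ x i *ᶻ χ i y)) +ᶻ χ y x
      ≡⟨ cong (λ z → (upsetSum n a -ᶻ z) +ᶻ χ y x) (∑-δ x<n (λ i → χ i y)) ⟩
    upsetSum n a -ᶻ χ x y +ᶻ χ y x ∎
    where open ≡-Reasoning

  reverseArc-other : ∀ x y {i j} → (x ≢ i ⊎ y ≢ j) → (y ≢ i ⊎ x ≢ j) → reverseArc x y a i j ≡ a i j
  reverseArc-other x y {i} {j} p q =
    trans (cong (a i j xor_) (cong₂ _∨_ (off p) (off q))) (Bool.xor-identityʳ _)
    where
    off : ∀ {x y} → (x ≢ i ⊎ y ≢ j) → sameArc x y i j ≡ false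
    off {x} {y} (inj₁ x≢i) rewrite dec-false (x ℕ.≟ i) x≢i = refl
    off {x} {y} (inj₂ y≢j) rewrite dec-false (y ℕ.≟ j) y≢j = Bool.∧-zeroʳ _

  reverseArc-reverses : ∀ {x y} → x ⟶ y → reverseArc x y a x y ≡ false
  reverseArc-reverses {x} {y} x⟶y rewrite x⟶y | dec-true (x ℕ.≟ x) refl | dec-true (y ℕ.≟ y) refl = refl

-- Uniqueness excludes cheap cycle reversals

χ-outside : ∀ {x z y} → x < z → Outside x z y → χ x y ≡ χ z y × χ y z ≡ χ y x
χ-outside x<z (inj₁ y<x) =
  trans (χ-no (ℕ.<-asym y<x)) (sym (χ-no (ℕ.<-asym y<z))) , trans (χ-yes y<z) (sym (χ-yes y<x))
  where y<z = ℕ.<-trans y<x x<z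
χ-outside x<z (inj₂ z<y) =
  trans (χ-yes x<y) (sym (χ-yes z<y)) , trans (χ-no (ℕ.<-asym z<y)) (sym (χ-no (ℕ.<-asym x<y)))
  where x<y = ℕ.<-trans x<z z<y

shift : ∀ {r s t p q : ℤ} → s ≡ t → r ≡ s -ᶻ p +ᶻ q → r ≡ t -ᶻ p +ᶻ q
shift refl eq = eq

-- The field `unique` merges minimality with uniqueness: a competitor with the same scores and no
-- more upsets already coincides with `a`.
record Optimal (n : ℕ) (a : ℕ → ℕ → Bool) : Set where
  field
    tournament : Tournament a
  open Tournament tournament
  field
    bounded : ∀ {i j} → i < j → i ⟶ j → j < n
    ordered : ∀ {k} → suc k < n → score n a k ≤ᶻ score n a (suc k)
    unique  : ∀ {b} → Tournament b → (∀ i → score n b i ≡ score n a i) →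
              upsetSum n b ≤ᶻ upsetSum n a → ∀ {i j} → i < n → j < n → b i j ≡ a i j

  ⟶-≥n : ∀ {x y} → x ⟶ y → n ≤ y → y < x
  ⟶-≥n {x} {y} x⟶y n≤y with ℕ.<-cmp x y
  ... | tri< x<y _ _ = contradiction (bounded x<y x⟶y) (ℕ.≤⇒≯ n≤y)
  ... | tri≈ _ x≡y _ = contradiction x≡y (⟶⇒≢ x⟶y)
  ... | tri> _ _ y<x = y<x

  -- A vertex from `n` on is beaten only by larger ones, so a cycle through it, followed backwards,
  -- would increase forever.
  4-cycle-<n : ∀ {x y z w} → x ⟶ y → y ⟶ z → z ⟶ w → w ⟶ x → x < n
  4-cycle-<n x⟶y y⟶z z⟶w w⟶x = ℕ.≰⇒> λ n≤x →
    let x<w = ⟶-≥n w⟶x n≤x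
        n≤w = ℕ.≤-trans n≤x (ℕ.<⇒≤ x<w)
        w<z = ⟶-≥n z⟶w n≤w
        n≤z = ℕ.≤-trans n≤w (ℕ.<⇒≤ w<z)
        z<y = ⟶-≥n y⟶z n≤z
        y<x = ⟶-≥n x⟶y (ℕ.≤-trans n≤z (ℕ.<⇒≤ z<y))
    in ℕ.<-irrefl refl (ℕ.<-trans x<w (ℕ.<-trans w<z (ℕ.<-trans z<y y<x)))

  not-reversed : ∀ {b x y} → Tournament b → (∀ i → score n b i ≡ score n a i) →
    upsetSum n b ≤ᶻ upsetSum n a → x < n → y < n → x ⟶ y → b x y ≢ false
  not-reversed T b≡a W≤ x<n y<n x⟶y bxy
    with () ← trans (sym (trans (unique T b≡a W≤ x<n y<n) x⟶y)) bxy

  no-balanced-4-cycle : ∀ {x y z w} → x < z → Outside x z y → Outside x z w →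
    x ⟶ y → y ⟶ z → z ⟶ w → w ⟶ x → ⊥
  no-balanced-4-cycle {x} {y} {z} {w} x<z y-out w-out x⟶y y⟶z z⟶w w⟶x =
    not-reversed T₄ score₄ upsets₄ x<n y<n x⟶y reversed
    where
    x<n = 4-cycle-<n x⟶y y⟶z z⟶w w⟶x
    y<n = 4-cycle-<n y⟶z z⟶w w⟶x x⟶y
    z<n = 4-cycle-<n z⟶w w⟶x x⟶y y⟶z
    w<n = 4-cycle-<n w⟶x x⟶y y⟶z z⟶w
    x≢y = ⟶⇒≢ x⟶y
    y≢z = ⟶⇒≢ y⟶z
    z≢w = ⟶⇒≢ z⟶w
    w≢x = ⟶⇒≢ w⟶x
    x≢z = ℕ.<⇒≢ x<z
    y≢w : y ≢ w
    y≢w refl = ⟶-asym x⟶y w⟶x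

    -- The four vertices are distinct, so reversing one arc leaves the remaining arcs of the cycle
    -- in place.
    a₁ = reverseArc x y a
    a₂ = reverseArc y z a₁
    a₃ = reverseArc z w a₂
    a₄ = reverseArc w x a₃
    T₁ = reverseArc-tournament tournament x≢y
    T₂ = reverseArc-tournament T₁ y≢z
    T₃ = reverseArc-tournament T₂ z≢w
    T₄ = reverseArc-tournament T₃ w≢x

    y⟶₁z : a₁ y z ≡ true
    y⟶₁z = trans (reverseArc-other tournament x y (inj₁ x≢y) (inj₂ x≢z)) y⟶z
    z⟶₂w : a₂ z w ≡ true
    z⟶₂w = trans (reverseArc-other T₁ y z (inj₁ y≢z) (inj₂ y≢w))
          (trans (reverseArc-other tournament x y (inj₁ x≢z) (inj₁ y≢z)) z⟶w)
    w⟶₃x : a₃ w x ≡ true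
    w⟶₃x = trans (reverseArc-other T₂ z w (inj₁ z≢w) (inj₂ (x≢z ∘ sym)))
          (trans (reverseArc-other T₁ y z (inj₁ y≢w) (inj₁ z≢w))
          (trans (reverseArc-other tournament x y (inj₁ (w≢x ∘ sym)) (inj₁ y≢w)) w⟶x))
    reversed : a₄ x y ≡ false
    reversed = trans (reverseArc-other T₃ w x (inj₁ w≢x) (inj₂ (y≢w ∘ sym)))
              (trans (reverseArc-other T₂ z w (inj₁ (x≢z ∘ sym)) (inj₁ w≢x))
              (trans (reverseArc-other T₁ y z (inj₁ (x≢y ∘ sym)) (inj₁ (x≢z ∘ sym)))
                     (reverseArc-reverses tournament x⟶y)))

    score₄ : ∀ i → score n a₄ i ≡ score n a i
    score₄ i = trans
      (shift (shift (shift (reverseArc-score tournament x<n y<n x⟶y i)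
        (reverseArc-score T₁ y<n z<n y⟶₁z i)) (reverseArc-score T₂ z<n w<n z⟶₂w i))
        (reverseArc-score T₃ w<n x<n w⟶₃x i))
      (eq (score n a i) (δ x i) (δ y i) (δ z i) (δ w i))
      where
      eq : ∀ s x y z w → s -ᶻ x +ᶻ y -ᶻ y +ᶻ z -ᶻ z +ᶻ w -ᶻ w +ᶻ x ≡ s
      eq = solve-∀

    upsets₄ : upsetSum n a₄ ≤ᶻ upsetSum n a
    upsets₄ = ℤ.≤-reflexive (trans
      (shift (shift (shift (reverseArc-upsetSum tournament x<n y<n x⟶y)
        (reverseArc-upsetSum T₁ y<n z<n y⟶₁z)) (reverseArc-upsetSum T₂ z<n w<n z⟶₂w))
        (reverseArc-upsetSum T₃ w<n x<n w⟶₃x))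
      (eq (upsetSum n a) (proj₁ (χ-outside x<z y-out)) (proj₂ (χ-outside x<z y-out))
                         (proj₁ (χ-outside x<z w-out)) (proj₂ (χ-outside x<z w-out))))
      where
      eq′ : ∀ s p q r t → s -ᶻ p +ᶻ q -ᶻ q +ᶻ p -ᶻ r +ᶻ t -ᶻ t +ᶻ r ≡ s
      eq′ = solve-∀
      eq : ∀ s {p q r t p′ q′ r′ t′} → p ≡ p′ → q′ ≡ q → r ≡ r′ → t′ ≡ t →
           s -ᶻ p +ᶻ q -ᶻ q′ +ᶻ p′ -ᶻ r′ +ᶻ t′ -ᶻ t +ᶻ r ≡ s
      eq s {p} {q} {r} {t} refl refl refl refl = eq′ s p q r t

  -- Reversing the cycle `x ⟶ y ⟶ z ⟶ x` would replace two upsets by one.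
  transitive : ∀ {x y z} → x < y → y < z → x ⟶ y → y ⟶ z → x ⟶ z
  transitive {x} {y} {z} x<y y<z x⟶y y⟶z with ⟶-connex (ℕ.<⇒≢ (ℕ.<-trans x<y y<z))
  ... | inj₁ x⟶z = x⟶z
  ... | inj₂ z⟶x = ⊥-elim (not-reversed T₃ score₃ upsets₃ x<n y<n x⟶y reversed)
    where
    z<n = bounded y<z y⟶z
    y<n = ℕ.<-trans y<z z<n
    x<n = ℕ.<-trans x<y y<n
    x<z = ℕ.<-trans x<y y<z
    x≢y = ℕ.<⇒≢ x<y
    y≢z = ℕ.<⇒≢ y<z
    z≢x = ⟶⇒≢ z⟶x

    a₁ = reverseArc x y a
    a₂ = reverseArc y z a₁
    a₃ = reverseArc z x a₂
    T₁ = reverseArc-tournament tournament x≢y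
    T₂ = reverseArc-tournament T₁ y≢z
    T₃ = reverseArc-tournament T₂ z≢x

    y⟶₁z : a₁ y z ≡ true
    y⟶₁z = trans (reverseArc-other tournament x y (inj₁ x≢y) (inj₂ (z≢x ∘ sym))) y⟶z
    z⟶₂x : a₂ z x ≡ true
    z⟶₂x = trans (reverseArc-other T₁ y z (inj₁ y≢z) (inj₂ (x≢y ∘ sym)))
          (trans (reverseArc-other tournament x y (inj₁ (z≢x ∘ sym)) (inj₁ y≢z)) z⟶x)
    reversed : a₃ x y ≡ false
    reversed = trans (reverseArc-other T₂ z x (inj₁ z≢x) (inj₂ (y≢z ∘ sym)))
              (trans (reverseArc-other T₁ y z (inj₁ (x≢y ∘ sym)) (inj₁ z≢x))
                     (reverseArc-reverses tournament x⟶y))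

    score₃ : ∀ i → score n a₃ i ≡ score n a i
    score₃ i = trans
      (shift (shift (reverseArc-score tournament x<n y<n x⟶y i)
        (reverseArc-score T₁ y<n z<n y⟶₁z i)) (reverseArc-score T₂ z<n x<n z⟶₂x i))
      (eq (score n a i) (δ x i) (δ y i) (δ z i))
      where
      eq : ∀ s x y z → s -ᶻ x +ᶻ y -ᶻ y +ᶻ z -ᶻ z +ᶻ x ≡ s
      eq = solve-∀

    upsets₃ : upsetSum n a₃ ≤ᶻ upsetSum n a
    upsets₃ = subst (_≤ᶻ upsetSum n a) (sym (trans
      (shift (shift (reverseArc-upsetSum tournament x<n y<n x⟶y)
        (reverseArc-upsetSum T₁ y<n z<n y⟶₁z)) (reverseArc-upsetSum T₂ z<n x<n z⟶₂x))
      (eq (upsetSum n a) (χ-yes x<y) (χ-no (ℕ.<-asym x<y)) (χ-yes y<z) (χ-no (ℕ.<-asym y<z))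
                         (χ-no (ℕ.<-asym x<z)) (χ-yes x<z)))) (ℤ.i≤j⇒i-k≤j 1ℤ ℤ.≤-refl)
      where
      eq′ : ∀ s → s -ᶻ 1ℤ +ᶻ 0ℤ -ᶻ 1ℤ +ᶻ 0ℤ -ᶻ 0ℤ +ᶻ 1ℤ ≡ s -ᶻ 1ℤ
      eq′ = solve-∀
      eq : ∀ s {p q r t u v} → p ≡ 1ℤ → q ≡ 0ℤ → r ≡ 1ℤ → t ≡ 0ℤ → u ≡ 0ℤ → v ≡ 1ℤ →
           s -ᶻ p +ᶻ q -ᶻ r +ᶻ t -ᶻ u +ᶻ v ≡ s -ᶻ 1ℤ
      eq s refl refl refl refl refl refl = eq′ s

  gain? : ∀ k → Dec (∃[ y ] y < n × suc k ⟶ y × y ⟶ k)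
  gain? k = ℕ.anyUpTo? (λ y → (suc k ⟶? y) ×-dec (y ⟶? k)) n

  no-score-drop : ∀ {k} → suc k < n → ¬ (score n a (suc k) ≤ᶻ -1ℤ +ᶻ score n a k)
  no-score-drop 1+k<n drop = ℤ.<-irrefl refl (ℤ.<-≤-trans (ℤ.i≤pred[j]⇒i<j drop) (ordered 1+k<n))

  ι≤1 : ∀ b → ι b ≤ᶻ 1ℤ
  ι≤1 true  = ℤ.≤-refl
  ι≤1 false = ℤ.+≤+ z≤n

  -- Suppose `k ⟶ suc k`. A vertex `y` with `suc k ⟶ y ⟶ k` contradicts transitivity, whether below
  -- or above the pair. Without such a vertex, `suc k` beats only what `k` beats, and not itself, so
  -- its score is smaller, against monotonicity.
  ascent : ∀ k → suc k ⟶ k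
  ascent k = ⟶-flip (ℕ.1+n≢n ∘ sym) main
    where
    main : ¬ (k ⟶ suc k)
    main k⟶1+k with gain? k
    ... | yes (y , _ , 1+k⟶y , y⟶k) with ℕ.<-cmp y k
    ...   | tri< y<k _ _ = ⟶-asym 1+k⟶y (transitive y<k (ℕ.n<1+n k) y⟶k k⟶1+k)
    ...   | tri≈ _ y≡k _ = ⟶⇒≢ y⟶k y≡k
    ...   | tri> _ _ k<y = ⟶-asym y⟶k (transitive (ℕ.n<1+n k) (ℕ.≤∧≢⇒< k<y (⟶⇒≢ 1+k⟶y)) k⟶1+k 1+k⟶y)
    main k⟶1+k | no none = no-score-drop 1+k<n (ℤ.≤-trans (∑-mono n pointwise) (ℤ.≤-reflexive total))
      where
      1+k<n = bounded (ℕ.n<1+n k) k⟶1+k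

      pointwise : ∀ {j} → j < n → ι (a (suc k) j) ≤ᶻ ι (a k j) -ᶻ δ (suc k) j
      pointwise {j} j<n with suc k ℕ.≟ j
      ... | yes refl rewrite irrefl (suc k) | k⟶1+k | δ-refl k = ℤ.≤-refl
      ... | no 1+k≢j rewrite δ-≢ 1+k≢j | ℤ.+-identityʳ (ι (a k j)) with suc k ⟶? j
      ...   | no ¬1+k⟶j rewrite Bool.¬-not ¬1+k⟶j = 0≤ι (a k j)
        where
        0≤ι : ∀ b → 0ℤ ≤ᶻ ι b
        0≤ι true  = ℤ.+≤+ z≤n
        0≤ι false = ℤ.≤-refl
      ...   | yes 1+k⟶j with ⟶-connex {k} {j} (λ { refl → ⟶-asym k⟶1+k 1+k⟶j })
      ...     | inj₁ k⟶j rewrite k⟶j = ι≤1 _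
      ...     | inj₂ j⟶k = contradiction (j , j<n , 1+k⟶j , j⟶k) none

      total : ∑ n (λ j → ι (a k j) -ᶻ δ (suc k) j) ≡ -1ℤ +ᶻ score n a k
      total = begin
        ∑ n (λ j → ι (a k j) -ᶻ δ (suc k) j)  ≡⟨ ∑-- n (λ j → ι (a k j)) (δ (suc k)) ⟩
        score n a k -ᶻ ∑ n (δ (suc k))        ≡⟨ cong (λ z → score n a k -ᶻ z) (∑-δ-1 1+k<n) ⟩
        score n a k -ᶻ 1ℤ                     ≡⟨ ℤ.+-comm (score n a k) -1ℤ ⟩
        -1ℤ +ᶻ score n a k                    ∎
        where open ≡-Reasoning

  -- With two drops the score falls by at least 2 - 1: balanced cycles exclude any gain except the
  -- arc from `suc k` to `k`, which the term `δ k` accounts for. This contradicts monotonicity.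
  drop-unique : ∀ {k x y} → k ⟶ x → x ⟶ suc k → k ⟶ y → y ⟶ suc k → x ≡ y
  drop-unique {k} {x} {y} k⟶x x⟶1+k k⟶y y⟶1+k with x ℕ.≟ y
  ... | yes x≡y = x≡y
  ... | no x≢y = ⊥-elim (no-score-drop 1+k<n (ℤ.≤-trans (∑-mono n pointwise) (ℤ.≤-reflexive total)))
    where
    1+k<n : suc k < n
    1+k<n = ℕ.≰⇒> λ n≤1+k → let 1+k<x = ⟶-≥n x⟶1+k n≤1+k in
      ℕ.<⇒≱ (bounded (ℕ.<-trans (ℕ.n<1+n k) 1+k<x) k⟶x) (ℕ.≤-trans n≤1+k (ℕ.<⇒≤ 1+k<x))
    k<n = ℕ.<-trans (ℕ.n<1+n k) 1+k<n

    below-n : ∀ {x} → k ⟶ x → x < n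
    below-n k⟶x = ℕ.≰⇒> λ n≤x → ℕ.<-asym (ℕ.<-≤-trans k<n n≤x) (⟶-≥n k⟶x n≤x)

    no-gain : ∀ {j} → suc k ⟶ j → ¬ (j ⟶ k)
    no-gain 1+k⟶j j⟶k = no-balanced-4-cycle (ℕ.n<1+n k)
      (outside-step (⟶⇒≢ k⟶x ∘ sym) (⟶⇒≢ x⟶1+k)) (outside-step (⟶⇒≢ j⟶k) (⟶⇒≢ 1+k⟶j ∘ sym))
      k⟶x x⟶1+k 1+k⟶j j⟶k

    loses : ∀ {x} → x ⟶ suc k → a (suc k) x ≡ false
    loses x⟶1+k = Bool.¬-not (⟶-asym x⟶1+k)

    bound : ∀ {c d b p q r} → c ≡ d → a k b ≡ p → δ x b ≡ q → δ y b ≡ r → {s : ℤ} → δ k b ≡ s →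
            ι d ≤ᶻ (ι p -ᶻ q -ᶻ r) +ᶻ s → ι c ≤ᶻ (ι (a k b) -ᶻ δ x b -ᶻ δ y b) +ᶻ δ k b
    bound refl refl refl refl refl le = le

    pointwise : ∀ {j} → j < n → ι (a (suc k) j) ≤ᶻ (ι (a k j) -ᶻ δ x j -ᶻ δ y j) +ᶻ δ k j
    pointwise {j} _ with k ℕ.≟ j | x ℕ.≟ j | y ℕ.≟ j
    ... | yes refl | yes refl | _ = contradiction refl (⟶⇒≢ k⟶x)
    ... | yes refl | no _ | yes refl = contradiction refl (⟶⇒≢ k⟶y)
    ... | yes refl | no x≢j | no y≢j =
      bound refl (irrefl k) (δ-≢ x≢j) (δ-≢ y≢j) (δ-refl k) (ι≤1 _)
    ... | no k≢j | yes refl | yes refl = contradiction refl x≢y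
    ... | no k≢j | yes refl | no y≢j =
      bound (loses x⟶1+k) k⟶x (δ-refl x) (δ-≢ y≢j) (δ-≢ k≢j) ℤ.≤-refl
    ... | no k≢j | no x≢j | yes refl =
      bound (loses y⟶1+k) k⟶y (δ-≢ x≢j) (δ-refl y) (δ-≢ k≢j) ℤ.≤-refl
    ... | no k≢j | no x≢j | no y≢j with suc k ⟶? j
    ...   | no ¬1+k⟶j =
      bound (Bool.¬-not ¬1+k⟶j) refl (δ-≢ x≢j) (δ-≢ y≢j) (δ-≢ k≢j) (0≤ (a k j))
      where
      0≤ : ∀ b → 0ℤ ≤ᶻ ι b -ᶻ 0ℤ -ᶻ 0ℤ +ᶻ 0ℤ
      0≤ true  = ℤ.+≤+ z≤n
      0≤ false = ℤ.≤-refl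
    ...   | yes 1+k⟶j =
      bound 1+k⟶j (⟶-flip (k≢j ∘ sym) (no-gain 1+k⟶j)) (δ-≢ x≢j) (δ-≢ y≢j) (δ-≢ k≢j) ℤ.≤-refl

    total : ∑ n (λ j → (ι (a k j) -ᶻ δ x j -ᶻ δ y j) +ᶻ δ k j) ≡ -1ℤ +ᶻ score n a k
    total = begin
      ∑ n (λ j → (ι (a k j) -ᶻ δ x j -ᶻ δ y j) +ᶻ δ k j)
        ≡⟨ ∑-+ n _ (δ k) ⟩
      ∑ n (λ j → ι (a k j) -ᶻ δ x j -ᶻ δ y j) +ᶻ ∑ n (δ k)
        ≡⟨ cong₂ _+ᶻ_ (trans (∑-- n _ (δ y)) (cong (_-ᶻ ∑ n (δ y)) (∑-- n _ (δ x)))) (∑-δ-1 k<n) ⟩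
      (score n a k -ᶻ ∑ n (δ x) -ᶻ ∑ n (δ y)) +ᶻ 1ℤ
        ≡⟨ cong₂ (λ p q → (score n a k -ᶻ p -ᶻ q) +ᶻ 1ℤ) (∑-δ-1 (below-n k⟶x)) (∑-δ-1 (below-n k⟶y)) ⟩
      (score n a k -ᶻ 1ℤ -ᶻ 1ℤ) +ᶻ 1ℤ
        ≡⟨ eq (score n a k) ⟩
      -1ℤ +ᶻ score n a k ∎
      where
      open ≡-Reasoning
      eq : ∀ s → (s -ᶻ 1ℤ -ᶻ 1ℤ) +ᶻ 1ℤ ≡ -1ℤ +ᶻ s
      eq = solve-∀

  rigid : Rigid n a
  rigid = record
    { tournament = tournament ; bounded = bounded ; transitive = transitive
    ; no-balanced-4-cycle = no-balanced-4-cycle ; ascent = ascent ; drop-unique = drop-unique }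

-- Symmetric segments

applyUpTo-cong : ∀ {f g : ℕ → ℤ} n → (∀ {i} → i < n → f i ≡ g i) → applyUpTo f n ≡ applyUpTo g n
applyUpTo-cong zero    f≡g = refl
applyUpTo-cong (suc n) f≡g = cong₂ _∷_ (f≡g (s≤s z≤n)) (applyUpTo-cong n (f≡g ∘ s≤s))

applyUpTo-++ : ∀ (f : ℕ → ℤ) m n → applyUpTo f (m + n) ≡ applyUpTo f m ++ applyUpTo (λ i → f (m + i)) n
applyUpTo-++ f zero    n = refl
applyUpTo-++ f (suc m) n = cong (f 0 ∷_) (applyUpTo-++ (f ∘ suc) m n)

applyUpTo-const : ∀ (c : ℤ) n → applyUpTo (λ _ → c) n ≡ replicate n c
applyUpTo-const c zero    = refl
applyUpTo-const c (suc n) = cong (c ∷_) (applyUpTo-const c n)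

applyUpTo-∸ : ∀ (f : ℕ → ℤ) n → applyUpTo (λ i → f (n ∸ suc i)) n ≡ applyDownFrom f n
applyUpTo-∸ f zero    = refl
applyUpTo-∸ f (suc n) = cong (f n ∷_) (applyUpTo-∸ f n)

record IsRamp (p z : ℕ) (f : ℕ → ℤ) : Set where
  field
    positive : ∀ {i} → i < p → f i ≡ +[1+ p ∸ suc i ]
    zeros    : ∀ {i} → i < z → f (p + i) ≡ 0ℤ
    negative : ∀ {i} → i < p → f (p + (z + i)) ≡ -[1+ i ]

  applyUpTo≡ramp : applyUpTo f (p + (z + p)) ≡ ramp p z
  applyUpTo≡ramp = trans (applyUpTo-++ f p (z + p)) (cong₂ _++_
    (trans (applyUpTo-cong p positive) (applyUpTo-∸ +[1+_] p))
    (trans (applyUpTo-++ (λ i → f (p + i)) z p) (cong₂ _++_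
      (trans (applyUpTo-cong z zeros) (applyUpTo-const 0ℤ z))
      (applyUpTo-cong p negative))))

module Segments {n a} (rigid : Rigid n a) where
  open Rigid rigid

  h : ℕ → ℤ
  h k = score n a k -ᶻ + k

  -- A neutral vertex beats exactly the vertices below it.
  neutral⇒h≡0 : ∀ {k} → k < n → Neutral k → h k ≡ 0ℤ
  neutral⇒h≡0 {k} k<n (no-in , ¬out) =
    trans (cong (_-ᶻ + k) (trans (∑-cong {n} (λ {j} _ → pointwise j)) (∑-χ (ℕ.<⇒≤ k<n)))) (ℤ.+-inverseʳ (+ k))
    where
    pointwise : ∀ j → ι (a k j) ≡ χ j k
    pointwise j with j ℕ.<? k
    ... | yes j<k = trans (cong ι (⟶-flip (ℕ.<⇒≢ j<k) (no-in j<k))) (sym (χ-yes j<k))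
    ... | no j≮k = trans (cong ι (Bool.¬-not ¬k⟶j)) (sym (χ-no j≮k))
      where
      ¬k⟶j : ¬ (k ⟶ j)
      ¬k⟶j k⟶j = ¬out (j , ℕ.≤∧≢⇒< (ℕ.≮⇒≥ j≮k) (⟶⇒≢ k⟶j) , k⟶j)

  -- Compared with `k`, the vertex `suc k` loses `x` and gains `k`. The score is unchanged while the
  -- subtracted index grows by one.
  drop⇒h-suc : ∀ {k x} → suc k < n → Drop k x → h (suc k) ≡ h k -ᶻ 1ℤ
  drop⇒h-suc {k} {x} 1+k<n drop@(k⟶x , x⟶1+k) = trans (cong (_-ᶻ + suc k) score-eq) (eq (score n a k) (+ k))
    where
    eq : ∀ s k → s -ᶻ (1ℤ +ᶻ k) ≡ s -ᶻ k -ᶻ 1ℤ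
    eq = solve-∀
    k<n = ℕ.<-trans (ℕ.n<1+n k) 1+k<n
    x<n : x < n
    x<n with ℕ.<-≤-connex k x
    ... | inj₁ k<x = bounded k<x k⟶x
    ... | inj₂ x≤k = ℕ.≤-<-trans x≤k k<n

    values : ∀ {b j c p} → a (suc k) j ≡ b → a k j ≡ c → δ x j ≡ p → {q : ℤ} → δ k j ≡ q →
             ι b ≡ (ι c -ᶻ p) +ᶻ q → ι (a (suc k) j) ≡ (ι (a k j) -ᶻ δ x j) +ᶻ δ k j
    values refl refl refl refl e = e

    pointwise : ∀ j → ι (a (suc k) j) ≡ (ι (a k j) -ᶻ δ x j) +ᶻ δ k j
    pointwise j with k ℕ.≟ j | x ℕ.≟ j
    ... | yes refl | yes refl = contradiction refl (⟶⇒≢ k⟶x)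
    ... | yes refl | no x≢k = values (ascent k) (irrefl k) (δ-≢ x≢k) (δ-refl k) refl
    ... | no k≢x | yes refl = values (Bool.¬-not (⟶-asym x⟶1+k)) k⟶x (δ-refl x) (δ-≢ k≢x) refl
    ... | no k≢j | no x≢j with k ⟶? j
    ...   | yes k⟶j = values (drop-⟶ʳ drop k⟶j (x≢j ∘ sym)) k⟶j (δ-≢ x≢j) (δ-≢ k≢j) refl
    ...   | no ¬k⟶j = values (Bool.¬-not λ 1+k⟶j → ¬k⟶j (drop-⟶ˡ drop 1+k⟶j (k≢j ∘ sym)))
                        (Bool.¬-not ¬k⟶j) (δ-≢ x≢j) (δ-≢ k≢j) refl

    score-eq : score n a (suc k) ≡ score n a k
    score-eq = begin
      score n a (suc k)                                 ≡⟨ ∑-cong {n} (λ {j} _ → pointwise j) ⟩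
      ∑ n (λ j → (ι (a k j) -ᶻ δ x j) +ᶻ δ k j)         ≡⟨ ∑-+ n _ (δ k) ⟩
      ∑ n (λ j → ι (a k j) -ᶻ δ x j) +ᶻ ∑ n (δ k)       ≡⟨ cong₂ _+ᶻ_ (∑-- n _ (δ x)) (∑-δ-1 k<n) ⟩
      (score n a k -ᶻ ∑ n (δ x)) +ᶻ 1ℤ                  ≡⟨ cong (λ z → (score n a k -ᶻ z) +ᶻ 1ℤ) (∑-δ-1 x<n) ⟩
      (score n a k -ᶻ 1ℤ) +ᶻ 1ℤ                         ≡⟨ eq′ (score n a k) ⟩
      score n a k                                       ∎
      where
      open ≡-Reasoning
      eq′ : ∀ s → (s -ᶻ 1ℤ) +ᶻ 1ℤ ≡ s
      eq′ = solve-∀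

  module _ {s} (b : Block s) where
    open Block b

    -- The sources run from `s` to `height + s`, both included.
    p = suc height
    z = first-sink ∸ (p + s)

    p+s≡ : p + s ≡ suc last
    p+s≡ = cong suc last≡

    z+p+s≡ : s + (p + z) ≡ first-sink
    z+p+s≡ = begin
      s + (p + z)  ≡⟨ sym (ℕ.+-assoc s p z) ⟩
      s + p + z    ≡⟨ cong (_+ z) (ℕ.+-comm s p) ⟩
      p + s + z    ≡⟨ ℕ.m+[n∸m]≡n (ℕ.≤-trans (ℕ.≤-reflexive p+s≡) (ℕ.<⇒≤ gap)) ⟩
      first-sink   ∎
      where open ≡-Reasoning

    1≤z : 1 ≤ z
    1≤z = ℕ.m<n⇒0<n∸m (subst (_< first-sink) (sym p+s≡) gap)

    end≡ : s + (p + (z + p)) ≡ suc (height + first-sink)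
    end≡ = begin
      s + (p + (z + p))     ≡⟨ cong (λ x → s + x) (sym (ℕ.+-assoc p z p)) ⟩
      s + (p + z + p)       ≡⟨ sym (ℕ.+-assoc s (p + z) p) ⟩
      s + (p + z) + p       ≡⟨ cong (_+ p) z+p+s≡ ⟩
      first-sink + p        ≡⟨ ℕ.+-comm first-sink p ⟩
      p + first-sink        ∎
      where open ≡-Reasoning

    first-sink<n : first-sink < n
    first-sink<n = ℕ.≤-<-trans (ℕ.m≤n+m first-sink height) inside

    h-neutral : ∀ {k} → last < k → k < first-sink → h k ≡ 0ℤ
    h-neutral last<k k<v = neutral⇒h≡0 (ℕ.<-trans k<v first-sink<n) (neutral last<k k<v)

    -- Works backwards from the neutral vertex `suc last`, where the value is 0, adding 1 for each
    -- drop.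
    h-source : ∀ d {t} → t + d ≡ p → h (s + t) ≡ + d
    h-source zero {t} t≡p = trans (cong h (trans (cong (λ x → s + x) (trans (sym (ℕ.+-identityʳ t)) t≡p)) (trans (ℕ.+-comm s p) p+s≡)))
      (h-neutral (ℕ.n<1+n last) gap)
    h-source (suc d) {t} t+1+d≡p =
      trans (eq (h (s + t))) (cong (1ℤ +ᶻ_) (trans (sym (drop⇒h-suc 1+s+t<n drop)) h-next))
      where
      1+t+d≡p = trans (sym (ℕ.+-suc t d)) t+1+d≡p
      t≤height : t ≤ height
      t≤height = ℕ.≤-trans (ℕ.m≤m+n t d) (ℕ.≤-reflexive (ℕ.suc-injective 1+t+d≡p))
      s+t≤last : s + t ≤ last
      s+t≤last = ℕ.≤-trans (ℕ.+-monoʳ-≤ s t≤height) (ℕ.≤-reflexive (trans (ℕ.+-comm s height) last≡))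
      1+s+t<n : suc (s + t) < n
      1+s+t<n = ℕ.<-trans (ℕ.≤-<-trans (s≤s s+t≤last) gap) first-sink<n
      drop = proj₂ (sources (ℕ.m≤m+n s t) s+t≤last)
      h-next : h (suc (s + t)) ≡ + d
      h-next = trans (cong h (sym (ℕ.+-suc s t))) (h-source d 1+t+d≡p)
      eq : ∀ x → x ≡ 1ℤ +ᶻ (x -ᶻ 1ℤ)
      eq = solve-∀

    -- Works forwards from the last neutral vertex `first-sink ∸ 1`, subtracting 1 for each drop.
    h-sink : ∀ i → i < p → h (first-sink + i) ≡ -[1+ i ]
    h-sink zero _ = trans (cong h (trans (ℕ.+-identityʳ first-sink) v≡)) (trans
      (drop⇒h-suc (subst (_< n) v≡ first-sink<n) (proj₂ (sinks (ℕ.≤-reflexive v≡)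
        (ℕ.≤-trans (ℕ.≤-reflexive (sym v≡)) (ℕ.m≤n+m first-sink height)))))
      (cong (_-ᶻ 1ℤ) (h-neutral last<v-1 (ℕ.≤-reflexive (sym v≡)))))
      where
      v≡ : first-sink ≡ suc (first-sink ∸ 1)
      v≡ = sym (ℕ.m+[n∸m]≡n (ℕ.≤-trans (s≤s z≤n) gap))
      last<v-1 : last < first-sink ∸ 1
      last<v-1 = s≤s⁻¹ (subst (suc last <_) v≡ gap)
    h-sink (suc i) 1+i<p = trans (cong h (ℕ.+-suc first-sink i)) (trans
      (drop⇒h-suc 1+v+i<n (proj₂ (sinks (ℕ.m≤n⇒m≤1+n (ℕ.m≤m+n first-sink i)) v+i<)))
      (trans (cong (_-ᶻ 1ℤ) (h-sink i (ℕ.<⇒≤ 1+i<p))) (cong (-[1+_] ∘ suc) (ℕ.+-identityʳ i))))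
      where
      v+i< : first-sink + i < height + first-sink
      v+i< = subst (first-sink + i <_) (ℕ.+-comm first-sink height) (ℕ.+-monoʳ-< first-sink (s≤s⁻¹ 1+i<p))
      1+v+i<n : suc (first-sink + i) < n
      1+v+i<n = ℕ.≤-<-trans v+i< inside

    h-isRamp : IsRamp p z (λ i → h (s + i))
    h-isRamp = record
      { positive = λ {i} i<p → h-source (suc (p ∸ suc i)) (trans (ℕ.+-suc i _) (ℕ.m+[n∸m]≡n i<p))
      ; zeros = λ {i} i<z → h-neutral
          (ℕ.≤-trans (ℕ.≤-reflexive (trans (sym p+s≡) (ℕ.+-comm p s))) (ℕ.+-monoʳ-≤ s (ℕ.m≤m+n p i)))
          (subst (s + (p + i) <_) z+p+s≡ (ℕ.+-monoʳ-< s (ℕ.+-monoʳ-< p i<z)))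
      ; negative = λ {i} i<p → trans (cong h (begin
          s + (p + (z + i))  ≡⟨ cong (λ x → s + x) (sym (ℕ.+-assoc p z i)) ⟩
          s + (p + z + i)    ≡⟨ sym (ℕ.+-assoc s (p + z) i) ⟩
          s + (p + z) + i    ≡⟨ cong (_+ i) z+p+s≡ ⟩
          first-sink + i     ∎)) (h-sink i i<p)
      }
      where open ≡-Reasoning

  -- Segments are split off from the left, always at an uncrossed cut. If `s` wins no upset, it is
  -- neutral and forms the segment (0); otherwise `block` gives a ramp that ends at the next
  -- uncrossed cut. The fuel is there because the length left after a ramp is not structurally
  -- smaller.
  segments : ∀ fuel {s m} → m ≤ fuel → s + m ≡ n → Uncrossed s →
    ∃[ Hs ] All Symmetric Hs × applyUpTo (λ i → h (s + i)) m ≡ concat Hs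
  segments _ {m = zero} _ _ _ = [] , [] , refl
  segments (suc fuel) {s} {suc m} m<fuel s+m≡n uncrossed-s with out? s
  ... | no ¬out = let Hs , sym-Hs , eq = segments fuel (s≤s⁻¹ m<fuel) (trans (sym (ℕ.+-suc s m)) s+m≡n) uncrossed in
      (0ℤ ∷ []) ∷ Hs , inj₁ (1 , s≤s z≤n , refl) ∷ sym-Hs ,
      cong₂ _∷_ (trans (cong h (ℕ.+-identityʳ s)) (neutral⇒h≡0 s<n ((λ y<s → uncrossed-s y<s ℕ.≤-refl) , ¬out)))
        (trans (applyUpTo-cong m (λ {i} _ → cong h (ℕ.+-suc s i))) eq)
    where
    s<n : s < n
    s<n = subst (s <_) s+m≡n (ℕ.m<m+n s (s≤s z≤n))
    uncrossed : Uncrossed (suc s)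
    uncrossed {x} {y} x<1+s s<y x⟶y with ℕ.m≤n⇒m<n∨m≡n (s≤s⁻¹ x<1+s)
    ... | inj₁ x<s = uncrossed-s x<s (ℕ.<⇒≤ s<y) x⟶y
    ... | inj₂ refl = ¬out (y , s<y , x⟶y)
  ... | yes out with block uncrossed-s (lastOut out)
  ...   | b =
      let Hs , sym-Hs , eq = segments fuel {s + L} {m′} m′≤fuel s+L+m′≡n
                               (subst Uncrossed (sym (end≡ b)) (Block.uncrossed b)) in
      ramp (p b) (z b) ∷ Hs ,
      inj₂ (p b , z b , s≤s z≤n , 1≤z b , refl) ∷ sym-Hs ,
      (begin
        applyUpTo (λ i → h (s + i)) (suc m)
          ≡⟨ cong (applyUpTo (λ i → h (s + i))) 1+m≡L+m′ ⟩
        applyUpTo (λ i → h (s + i)) (L + m′)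
          ≡⟨ applyUpTo-++ (λ i → h (s + i)) L m′ ⟩
        applyUpTo (λ i → h (s + i)) L ++ applyUpTo (λ i → h (s + (L + i))) m′
          ≡⟨ cong₂ _++_ (IsRamp.applyUpTo≡ramp (h-isRamp b))
               (trans (applyUpTo-cong m′ (λ {i} _ → cong h (sym (ℕ.+-assoc s L i)))) eq) ⟩
        ramp (p b) (z b) ++ concat Hs ∎)
    where
    open ≡-Reasoning
    L = p b + (z b + p b)
    m′ = n ∸ (s + L)
    s+L+m′≡n : s + L + m′ ≡ n
    s+L+m′≡n = ℕ.m+[n∸m]≡n (subst (_≤ n) (sym (end≡ b)) (Block.inside b))
    1+m≡L+m′ : suc m ≡ L + m′
    1+m≡L+m′ = ℕ.+-cancelˡ-≡ s _ _ (trans s+m≡n (trans (sym s+L+m′≡n) (ℕ.+-assoc s L m′)))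
    m′≤fuel : m′ ≤ fuel
    m′≤fuel = s≤s⁻¹ (ℕ.≤-trans (s≤s (ℕ.m≤n+m m′ _)) (subst (_≤ suc fuel) 1+m≡L+m′ m<fuel))

-- Certificates of uniqueness

-- Upsets are the arcs of a flow whose divergence is the normalized score
-- vector, each at the same cost; a potential under which used arcs have negative
-- and unused ones positive reduced cost certifies a unique cheapest flow.
record Certificate (n : ℕ) (a : ℕ → ℕ → Bool) : Set where
  field
    tournament : Tournament a
    cost       : ℤ
    potential  : ℕ → ℤ
    cost>0     : 0ℤ <ᶻ cost
    cheap      : ∀ {i j} → i < j → j < n → a i j ≡ true → cost <ᶻ potential i -ᶻ potential j
    expensive  : ∀ {i j} → i < j → j < n → a i j ≡ false → potential i -ᶻ potential j <ᶻ cost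

module Optimality {n a} (c : Certificate n a) {b} (Tb : Tournament b)
  (same-scores : ∀ {i} → i < n → score n b i ≡ score n a i) where

  open Certificate c renaming (tournament to Ta)

  -- `d` is the change from `a` to `b`. As the scores agree, the potentials cancel in the row sums
  -- of `κ i j *ᶻ d i j`, which leaves the cost of the change in upsets. For `i < j` the factor
  -- `κ i j -ᶻ κ j i` is the reduced cost, whose sign the certificate controls.
  κ d e : ℕ → ℕ → ℤ
  κ i j = cost *ᶻ χ i j -ᶻ potential i
  d i j = ι (b i j) -ᶻ ι (a i j)
  e i j = (κ i j -ᶻ κ j i) *ᶻ d i j

  d-anti : ∀ i j → d j i ≡ -ᶻ d i j
  d-anti i j with i ℕ.≟ j
  ... | yes refl rewrite Tournament.irrefl Ta i | Tournament.irrefl Tb i = refl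
  ... | no i≢j rewrite Tournament.anti Ta i≢j | Tournament.anti Tb i≢j = eq (b i j) (a i j)
    where
    eq : ∀ x y → ι (not x) -ᶻ ι (not y) ≡ -ᶻ (ι x -ᶻ ι y)
    eq true  true  = refl
    eq true  false = refl
    eq false true  = refl
    eq false false = refl

  ΔW = upsetSum n b -ᶻ upsetSum n a

  ∑κd : ∑ n (λ i → ∑ n (λ j → κ i j *ᶻ d i j)) ≡ cost *ᶻ ΔW
  ∑κd = begin
    ∑ n (λ i → ∑ n (λ j → κ i j *ᶻ d i j))
      ≡⟨ ∑-cong {n} (λ {i} i<n → row i i<n) ⟩
    ∑ n (λ i → cost *ᶻ (∑ n (λ j → χ i j *ᶻ ι (b i j)) -ᶻ ∑ n (λ j → χ i j *ᶻ ι (a i j))))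
      ≡⟨ ∑-*ˡ n cost _ ⟩
    cost *ᶻ ∑ n (λ i → ∑ n (λ j → χ i j *ᶻ ι (b i j)) -ᶻ ∑ n (λ j → χ i j *ᶻ ι (a i j)))
      ≡⟨ cong (cost *ᶻ_) (∑-- n _ _) ⟩
    cost *ᶻ ΔW ∎
    where
    open ≡-Reasoning
    expand : ∀ D x π y z → (D *ᶻ x -ᶻ π) *ᶻ (y -ᶻ z) ≡ D *ᶻ (x *ᶻ y -ᶻ x *ᶻ z) -ᶻ π *ᶻ (y -ᶻ z)
    expand = solve-∀
    cancel : ∀ x y p {s t} → s ≡ t → x *ᶻ y -ᶻ p *ᶻ (s -ᶻ t) ≡ x *ᶻ y
    cancel x y p {s} refl = cancel′ x y p s
      where
      cancel′ : ∀ x y p s → x *ᶻ y -ᶻ p *ᶻ (s -ᶻ s) ≡ x *ᶻ y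
      cancel′ = solve-∀
    row : ∀ i → i < n → ∑ n (λ j → κ i j *ᶻ d i j) ≡
      cost *ᶻ (∑ n (λ j → χ i j *ᶻ ι (b i j)) -ᶻ ∑ n (λ j → χ i j *ᶻ ι (a i j)))
    row i i<n = begin
      ∑ n (λ j → κ i j *ᶻ d i j)
        ≡⟨ ∑-cong {n} (λ {j} _ → expand cost (χ i j) (potential i) (ι (b i j)) (ι (a i j))) ⟩
      ∑ n (λ j → cost *ᶻ (χ i j *ᶻ ι (b i j) -ᶻ χ i j *ᶻ ι (a i j)) -ᶻ potential i *ᶻ d i j)
        ≡⟨ ∑-- n _ _ ⟩
      ∑ n (λ j → cost *ᶻ (χ i j *ᶻ ι (b i j) -ᶻ χ i j *ᶻ ι (a i j))) -ᶻ ∑ n (λ j → potential i *ᶻ d i j)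
        ≡⟨ cong₂ _-ᶻ_ (trans (∑-*ˡ n cost _) (cong (cost *ᶻ_) (∑-- n _ _)))
                      (trans (∑-*ˡ n (potential i) _) (cong (potential i *ᶻ_) (∑-- n _ _))) ⟩
      cost *ᶻ (∑ n (λ j → χ i j *ᶻ ι (b i j)) -ᶻ ∑ n (λ j → χ i j *ᶻ ι (a i j)))
        -ᶻ potential i *ᶻ (score n b i -ᶻ score n a i)
        ≡⟨ cancel cost _ (potential i) (same-scores i<n) ⟩
      cost *ᶻ (∑ n (λ j → χ i j *ᶻ ι (b i j)) -ᶻ ∑ n (λ j → χ i j *ᶻ ι (a i j))) ∎

  -- Since `d` is antisymmetric, `e` splits into a term and its transpose, and each contributes the
  -- sum `∑κd`.
  ∑e : ∑ n (λ i → ∑ n (e i)) ≡ (cost +ᶻ cost) *ᶻ ΔW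
  ∑e = begin
    ∑ n (λ i → ∑ n (e i))
      ≡⟨ ∑-cong {n} (λ {i} _ → trans (∑-cong {n} (λ {j} _ → split i j)) (∑-+ n _ _)) ⟩
    ∑ n (λ i → ∑ n (λ j → κ i j *ᶻ d i j) +ᶻ ∑ n (λ j → κ j i *ᶻ d j i))
      ≡⟨ ∑-+ n _ _ ⟩
    ∑ n (λ i → ∑ n (λ j → κ i j *ᶻ d i j)) +ᶻ ∑ n (λ i → ∑ n (λ j → κ j i *ᶻ d j i))
      ≡⟨ cong (∑ n (λ i → ∑ n (λ j → κ i j *ᶻ d i j)) +ᶻ_) (sym (∑-swap n n (λ i j → κ i j *ᶻ d i j))) ⟩
    ∑ n (λ i → ∑ n (λ j → κ i j *ᶻ d i j)) +ᶻ ∑ n (λ i → ∑ n (λ j → κ i j *ᶻ d i j))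
      ≡⟨ cong₂ _+ᶻ_ ∑κd ∑κd ⟩
    cost *ᶻ ΔW +ᶻ cost *ᶻ ΔW
      ≡⟨ sym (ℤ.*-distribʳ-+ ΔW cost cost) ⟩
    (cost +ᶻ cost) *ᶻ ΔW ∎
    where
    open ≡-Reasoning
    eq : ∀ x y z → (x -ᶻ y) *ᶻ z ≡ x *ᶻ z +ᶻ y *ᶻ (-ᶻ z)
    eq = solve-∀
    split : ∀ i j → e i j ≡ κ i j *ᶻ d i j +ᶻ κ j i *ᶻ d j i
    split i j = trans (eq (κ i j) (κ j i) (d i j)) (cong (λ z → κ i j *ᶻ d i j +ᶻ κ j i *ᶻ z) (sym (d-anti i j)))

  e-sym : ∀ i j → e j i ≡ e i j
  e-sym i j = trans (cong ((κ j i -ᶻ κ i j) *ᶻ_) (d-anti i j)) (eq (κ j i) (κ i j) (d i j))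
    where
    eq : ∀ x y z → (x -ᶻ y) *ᶻ (-ᶻ z) ≡ (y -ᶻ x) *ᶻ z
    eq = solve-∀

  -- A new upset of `b` has positive reduced cost; a dropped upset of `a` has negative reduced cost
  -- and enters with the opposite sign.
  e-sign-< : ∀ {i j} → i < j → j < n → (b i j ≡ a i j × e i j ≡ 0ℤ) ⊎ 0ℤ <ᶻ e i j
  e-sign-< {i} {j} i<j j<n with b i j | a i j in aij
  ... | true  | true  = inj₁ (refl , ℤ.*-zeroʳ (κ i j -ᶻ κ j i))
  ... | false | false = inj₁ (refl , ℤ.*-zeroʳ (κ i j -ᶻ κ j i))
  ... | true  | false = inj₂ (subst (0ℤ <ᶻ_)
    (eq cost (potential i) (potential j) (χ-yes i<j) (χ-no (ℕ.<-asym i<j)))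
    (<⇒0<- (expensive i<j j<n aij)))
    where
    eq′ : ∀ D p q → D -ᶻ (p -ᶻ q) ≡ ((D *ᶻ 1ℤ -ᶻ p) -ᶻ (D *ᶻ 0ℤ -ᶻ q)) *ᶻ 1ℤ
    eq′ = solve-∀
    eq : ∀ D p q {x y} → x ≡ 1ℤ → y ≡ 0ℤ → D -ᶻ (p -ᶻ q) ≡ ((D *ᶻ x -ᶻ p) -ᶻ (D *ᶻ y -ᶻ q)) *ᶻ 1ℤ
    eq D p q refl refl = eq′ D p q
  ... | false | true  = inj₂ (subst (0ℤ <ᶻ_)
    (eq cost (potential i) (potential j) (χ-yes i<j) (χ-no (ℕ.<-asym i<j)))
    (<⇒0<- (cheap i<j j<n aij)))
    where
    eq′ : ∀ D p q → p -ᶻ q -ᶻ D ≡ ((D *ᶻ 1ℤ -ᶻ p) -ᶻ (D *ᶻ 0ℤ -ᶻ q)) *ᶻ -1ℤ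
    eq′ = solve-∀
    eq : ∀ D p q {x y} → x ≡ 1ℤ → y ≡ 0ℤ → p -ᶻ q -ᶻ D ≡ ((D *ᶻ x -ᶻ p) -ᶻ (D *ᶻ y -ᶻ q)) *ᶻ -1ℤ
    eq D p q refl refl = eq′ D p q

  e-sign : ∀ {i j} → i < n → j < n → (b i j ≡ a i j × e i j ≡ 0ℤ) ⊎ 0ℤ <ᶻ e i j
  e-sign {i} {j} i<n j<n with ℕ.<-cmp i j
  ... | tri< i<j _ _ = e-sign-< i<j j<n
  ... | tri≈ _ refl _ = inj₁
    ( trans (Tournament.irrefl Tb i) (sym (Tournament.irrefl Ta i))
    , trans (cong (_*ᶻ d i i) (ℤ.+-inverseʳ (κ i i))) (ℤ.*-zeroˡ (d i i)))
  ... | tri> _ i≢j j<i with e-sign-< j<i i<n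
  ...   | inj₁ (bji≡aji , eji≡0) = inj₁
    ( trans (Tournament.anti Tb (i≢j ∘ sym)) (trans (cong not bji≡aji) (sym (Tournament.anti Ta (i≢j ∘ sym))))
    , trans (e-sym j i) eji≡0)
  ...   | inj₂ 0<eji = inj₂ (subst (0ℤ <ᶻ_) (e-sym i j) 0<eji)

  e≥0 : ∀ {i j} → i < n → j < n → 0ℤ ≤ᶻ e i j
  e≥0 i<n j<n with e-sign i<n j<n
  ... | inj₁ (_ , e≡0) = ℤ.≤-reflexive (sym e≡0)
  ... | inj₂ 0<e = ℤ.<⇒≤ 0<e

  instance
    2cost-positive : ℤ.Positive (cost +ᶻ cost)
    2cost-positive = ℤ.positive (ℤ.+-mono-< cost>0 cost>0)

  optimal : upsetSum n a ≤ᶻ upsetSum n b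
  optimal = ℤ.0≤i-j⇒j≤i (ℤ.*-cancelˡ-≤-pos 0ℤ ΔW (cost +ᶻ cost)
    (subst₂ _≤ᶻ_ (sym (ℤ.*-zeroʳ (cost +ᶻ cost))) ∑e
      (∑-nonneg n (λ i<n → ∑-nonneg n (e≥0 i<n)))))

  -- The nonnegative terms `e` then have a sum of at most 0, so none is positive, and by `e-sign`
  -- the tournaments agree everywhere.
  unique : upsetSum n b ≤ᶻ upsetSum n a → ∀ {i j} → i < n → j < n → b i j ≡ a i j
  unique Wb≤Wa {i} {j} i<n j<n with e-sign i<n j<n
  ... | inj₁ (b≡a , _) = b≡a
  ... | inj₂ 0<e = contradiction 0<e (ℤ.≤⇒≯ e≤0)
    where
    ∑e≤0 : ∑ n (λ i → ∑ n (e i)) ≤ᶻ 0ℤ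
    ∑e≤0 = subst₂ _≤ᶻ_ (sym ∑e) (ℤ.*-zeroʳ (cost +ᶻ cost))
      (ℤ.*-monoˡ-≤-nonNeg (cost +ᶻ cost) {{ℤ.nonNegative (ℤ.<⇒≤ (ℤ.+-mono-< cost>0 cost>0))}} (ℤ.i≤j⇒i-j≤0 Wb≤Wa))
    e≤0 : e i j ≤ᶻ 0ℤ
    e≤0 = ∑-nonneg⇒≤0 n (e≥0 i<n) (∑-nonneg⇒≤0 n (λ i<n → ∑-nonneg n (e≥0 i<n)) ∑e≤0 i<n) j<n

-- Realizing symmetric vectors and their concatenations

-- The two bounds on the potential make certificates composable: they control the potential
-- difference across a junction.
record Realization (H : List ℤ) : Set where
  field
    size        : ℕ
    beats       : ℕ → ℕ → Bool
    certificate : Certificate size beats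
  open Certificate certificate public
  field
    bound       : ℤ
    bound≥0     : 0ℤ ≤ᶻ bound
    potential≤0 : ∀ {i} → i < size → potential i ≤ᶻ 0ℤ
    -bound≤     : ∀ {i} → i < size → -ᶻ bound ≤ᶻ potential i
    scores      : applyUpTo (λ i → score size beats i -ᶻ + i) size ≡ H

module Band (p z : ℕ) (1≤z : 1 ≤ z) where

  q L : ℕ
  q = p + z
  L = p + (z + p)

  L≡q+p : L ≡ q + p
  L≡q+p = sym (ℕ.+-assoc p z p)

  1≤q : 1 ≤ q
  1≤q = ℕ.≤-trans 1≤z (ℕ.m≤n+m z p)

  -- The upsets are the pairs at distance at least q, so that a potential which
  -- is linear in the position tells them apart from the other pairs.
  band : ℕ → ℕ → Bool
  band i j = if i <ᵇ j then not (j <ᵇ i + q) else if j <ᵇ i then (i <ᵇ j + q) else false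

  band-< : ∀ {i j} → i < j → band i j ≡ not (j <ᵇ i + q)
  band-< i<j rewrite <ᵇ-yes i<j = refl

  band-> : ∀ {i j} → j < i → band i j ≡ (i <ᵇ j + q)
  band-> j<i rewrite <ᵇ-no (ℕ.<-asym j<i) | <ᵇ-yes j<i = refl

  band-irrefl : ∀ i → band i i ≡ false
  band-irrefl i rewrite <ᵇ-no (ℕ.<-irrefl {i} refl) = refl

  band-tournament : Tournament band
  band-tournament = record { irrefl = band-irrefl ; anti = anti }
    where
    anti : ∀ {i j} → i ≢ j → band j i ≡ not (band i j)
    anti {i} {j} i≢j with ℕ.<-cmp i j
    ... | tri< i<j _ _ = trans (band-> i<j) (trans (sym (Bool.not-involutive _)) (cong not (sym (band-< i<j))))
    ... | tri≈ _ i≡j _ = contradiction i≡j i≢j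
    ... | tri> _ _ j<i = trans (band-< j<i) (cong not (sym (band-> j<i)))

  ι-not : ∀ b → ι (not b) ≡ 1ℤ -ᶻ ι b
  ι-not true  = refl
  ι-not false = refl

  -- Vertex `i` beats the interval from `suc i ∸ q` to i - 1 and everything from `i + q` on. Writing
  -- this with initial segments lets `∑-χ` compute the score; truncated subtraction starts the
  -- interval at 0 when `i < q`.
  ι-band : ∀ i j → ι (band i j) ≡ (χ j i -ᶻ χ j (suc i ∸ q)) +ᶻ (1ℤ -ᶻ χ j (i + q))
  ι-band i j with ℕ.<-cmp i j
  ... | tri< i<j _ _ = trans (trans (cong ι (band-< i<j)) (ι-not (j <ᵇ i + q)))
      (values (χ-no (ℕ.<-asym i<j)) (χ-no (ℕ.≤⇒≯ (ℕ.≤-trans (ℕ.∸-monoʳ-≤ (suc i) 1≤q) (ℕ.<⇒≤ i<j)))))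
    where
    values : ∀ {x y w} → x ≡ 0ℤ → y ≡ 0ℤ → w ≡ (x -ᶻ y) +ᶻ w
    values refl refl = sym (ℤ.+-identityˡ _)
  ... | tri≈ _ refl _ = trans (cong ι (band-irrefl i))
      (values (χ-no (ℕ.<-irrefl {i} refl)) (χ-no (ℕ.≤⇒≯ (ℕ.∸-monoʳ-≤ (suc i) 1≤q))) (χ-yes (ℕ.m<m+n i 1≤q)))
    where
    values : ∀ {x y w} → x ≡ 0ℤ → y ≡ 0ℤ → w ≡ 1ℤ → 0ℤ ≡ (x -ᶻ y) +ᶻ (1ℤ -ᶻ w)
    values refl refl refl = refl
  ... | tri> _ _ j<i = trans (cong ι (band-> j<i)) (values (χ-yes j<i) (χ-yes (ℕ.<-≤-trans j<i (ℕ.m≤m+n i q))) shifted)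
    where
    shifted : ι (i <ᵇ j + q) ≡ 1ℤ -ᶻ χ j (suc i ∸ q)
    shifted with i ℕ.<? j + q
    ... | yes i<j+q = trans (χ-yes i<j+q) (cong (λ x → 1ℤ -ᶻ x) (sym (χ-no (ℕ.≤⇒≯
        (ℕ.≤-trans (ℕ.∸-monoˡ-≤ q i<j+q) (ℕ.≤-reflexive (ℕ.m+n∸n≡m j q)))))))
    ... | no i≮j+q = trans (χ-no i≮j+q) (cong (λ x → 1ℤ -ᶻ x) (sym (χ-yes
        (ℕ.≤-trans (ℕ.≤-reflexive (sym (ℕ.m+n∸n≡m (suc j) q))) (ℕ.∸-monoˡ-≤ q (s≤s (ℕ.≮⇒≥ i≮j+q)))))))
    values : ∀ {w x y v} → x ≡ 1ℤ → y ≡ 1ℤ → w ≡ 1ℤ -ᶻ v → w ≡ (x -ᶻ v) +ᶻ (1ℤ -ᶻ y)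
    values refl refl refl = sym (ℤ.+-identityʳ _)

  h : ℕ → ℤ
  h i = score L band i -ᶻ + i

  -- The value `x` stays open because it depends on whether `i + q` exceeds `L`: it is `i + q` for
  -- `i < p` and `L` from `p` on.
  h-band : ∀ {i x} → i < L → ∑ L (λ j → χ j (i + q)) ≡ x → h i ≡ + L -ᶻ x -ᶻ + (suc i ∸ q)
  h-band {i} {x} i<L ∑≡x = begin
    score L band i -ᶻ + i
      ≡⟨ cong (_-ᶻ + i) (∑-cong {L} (λ {j} _ → ι-band i j)) ⟩
    ∑ L (λ j → (χ j i -ᶻ χ j (suc i ∸ q)) +ᶻ (1ℤ -ᶻ χ j (i + q))) -ᶻ + i
      ≡⟨ cong (_-ᶻ + i) (trans (∑-+ L _ _) (cong₂ _+ᶻ_ (∑-- L _ _) (∑-- L _ _))) ⟩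
    (∑ L (λ j → χ j i) -ᶻ ∑ L (λ j → χ j (suc i ∸ q)))
      +ᶻ (∑ L (λ _ → 1ℤ) -ᶻ ∑ L (λ j → χ j (i + q))) -ᶻ + i
      ≡⟨ values (∑-χ (ℕ.<⇒≤ i<L)) (∑-χ (ℕ.≤-trans (ℕ.m∸n≤m (suc i) q) i<L)) (∑-1 L) ∑≡x ⟩
    + L -ᶻ x -ᶻ + (suc i ∸ q) ∎
    where
    open ≡-Reasoning
    eq : ∀ i s l x → (i -ᶻ s) +ᶻ (l -ᶻ x) -ᶻ i ≡ l -ᶻ x -ᶻ s
    eq = solve-∀
    values : ∀ {i′ s′ l′ x′ i s l x} → i′ ≡ i → s′ ≡ s → l′ ≡ l → x′ ≡ x →
             (i′ -ᶻ s′) +ᶻ (l′ -ᶻ x′) -ᶻ i ≡ l -ᶻ x -ᶻ s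
    values {i = i} {s} {l} {x} refl refl refl refl = eq i s l x

  h-isRamp : IsRamp p z h
  h-isRamp = record { positive = positive ; zeros = zeros ; negative = negative }
    where
    positive : ∀ {i} → i < p → h i ≡ +[1+ p ∸ suc i ]
    positive {i} i<p = trans
      (h-band (ℕ.<-≤-trans i<p (ℕ.m≤m+n p (z + p))) (∑-χ i+q≤L))
      (trans (cong (λ x → + L -ᶻ + (i + q) -ᶻ + x) (ℕ.m≤n⇒m∸n≡0 (ℕ.≤-trans i<p (ℕ.m≤m+n p z))))
             (trans (cong (λ x → + x -ᶻ + (i + q) -ᶻ 0ℤ) L≡) (eq (+ i) (+ q) (+ suc (p ∸ suc i)))))
      where
      p≡ : i + suc (p ∸ suc i) ≡ p
      p≡ = trans (ℕ.+-suc i _) (ℕ.m+[n∸m]≡n i<p)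
      L≡ : L ≡ q + (i + suc (p ∸ suc i))
      L≡ = trans L≡q+p (cong (λ x → q + x) (sym p≡))
      i+q≤L : i + q ≤ L
      i+q≤L = subst (i + q ≤_) (trans (ℕ.+-comm p q) (sym L≡q+p)) (ℕ.+-monoˡ-≤ q (ℕ.<⇒≤ i<p))
      eq : ∀ i q s → (q +ᶻ (i +ᶻ s)) -ᶻ (i +ᶻ q) -ᶻ 0ℤ ≡ s
      eq = solve-∀

    low : ∀ {i k} → p ≤ i → i < L → suc i ∸ q ≡ k → h i ≡ -ᶻ + k
    low {i} p≤i i<L refl = trans (h-band i<L (∑-χ-full L≤i+q)) (eq (+ L) (+ (suc i ∸ q)))
      where
      L≤i+q : L ≤ i + q
      L≤i+q = subst (_≤ i + q) (trans (ℕ.+-comm p q) (sym L≡q+p)) (ℕ.+-monoˡ-≤ q p≤i)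
      eq : ∀ l s → l -ᶻ l -ᶻ s ≡ -ᶻ s
      eq = solve-∀

    zeros : ∀ {i} → i < z → h (p + i) ≡ 0ℤ
    zeros {i} i<z = low (ℕ.m≤m+n p i) (ℕ.+-monoʳ-< p (ℕ.<-≤-trans i<z (ℕ.m≤m+n z p)))
      (ℕ.m≤n⇒m∸n≡0 (ℕ.+-monoʳ-< p i<z))

    negative : ∀ {i} → i < p → h (p + (z + i)) ≡ -[1+ i ]
    negative {i} i<p = low (ℕ.m≤m+n p (z + i)) (ℕ.+-monoʳ-< p (ℕ.+-monoʳ-< z i<p))
      (trans (cong (_∸ q) (trans (cong suc (sym (ℕ.+-assoc p z i))) (sym (ℕ.+-suc q i)))) (ℕ.m+n∸m≡n q (suc i)))

  realization : Realization (ramp p z)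
  realization = record
    { size = L
    ; beats = band
    ; certificate = record
      { tournament = band-tournament
      -- Potential differences are twice the distance, so the odd cost 2q - 1 separates distance q -
      -- 1 from distance q strictly within the integers.
      ; cost = + (q + q) -ᶻ 1ℤ
      ; potential = λ i → -ᶻ + (i + i)
      ; cost>0 = cost>0
      ; cheap = λ {i} {j} i<j _ → cheap {i} {j} i<j
      ; expensive = λ {i} {j} i<j _ → expensive {i} {j} i<j
      }
    ; bound = + (L + L)
    ; bound≥0 = ℤ.+≤+ z≤n
    ; potential≤0 = λ _ → ℤ.neg-mono-≤ (ℤ.+≤+ z≤n)
    ; -bound≤ = λ i<L → ℤ.neg-mono-≤ (ℤ.+≤+ (ℕ.+-mono-≤ (ℕ.<⇒≤ i<L) (ℕ.<⇒≤ i<L)))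
    ; scores = IsRamp.applyUpTo≡ramp h-isRamp
    }
    where
    cost>0 : 0ℤ <ᶻ + (q + q) -ᶻ 1ℤ
    cost>0 = <⇒0<- (ℤ.+<+ (ℕ.+-mono-≤ 1≤q 1≤q))

    cheap : ∀ {i j} → i < j → band i j ≡ true → + (q + q) -ᶻ 1ℤ <ᶻ -ᶻ + (i + i) -ᶻ (-ᶻ + (j + j))
    cheap {i} {j} i<j bij = <-gap (r + r) (subst (λ j → -ᶻ + (i + i) -ᶻ (-ᶻ + (j + j)) ≡ + (q + q) -ᶻ 1ℤ +ᶻ + suc (r + r))
        (ℕ.m+[n∸m]≡n i+q≤j) (eq (+ i) (+ q) (+ r)))
      where
      i+q≤j : i + q ≤ j
      i+q≤j = ℕ.≮⇒≥ λ j<i+q → case trans (sym bij) (trans (band-< i<j) (cong not (<ᵇ-yes j<i+q))) of λ ()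
      r = j ∸ (i + q)
      eq : ∀ i q r → -ᶻ (i +ᶻ i) -ᶻ (-ᶻ ((i +ᶻ q +ᶻ r) +ᶻ (i +ᶻ q +ᶻ r))) ≡ (q +ᶻ q) -ᶻ 1ℤ +ᶻ (1ℤ +ᶻ (r +ᶻ r))
      eq = solve-∀

    expensive : ∀ {i j} → i < j → band i j ≡ false → -ᶻ + (i + i) -ᶻ (-ᶻ + (j + j)) <ᶻ + (q + q) -ᶻ 1ℤ
    expensive {i} {j} i<j bij = <-gap (r + r) (trans (cancel (+ i) (+ q))
        (subst (λ x → (+ x +ᶻ + x) -ᶻ (+ i +ᶻ + i) -ᶻ 1ℤ ≡ -ᶻ + (i + i) -ᶻ (-ᶻ + (j + j)) +ᶻ + suc (r + r))
        (ℕ.m+[n∸m]≡n j<i+q) (eq (+ i) (+ j) (+ r))))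
      where
      j<i+q : j < i + q
      j<i+q = ℕ.≰⇒> λ i+q≤j → case trans (sym bij) (trans (band-< i<j) (cong not (<ᵇ-no (ℕ.≤⇒≯ i+q≤j)))) of λ ()
      r = i + q ∸ suc j
      cancel : ∀ i q → (q +ᶻ q) -ᶻ 1ℤ ≡ ((i +ᶻ q) +ᶻ (i +ᶻ q)) -ᶻ (i +ᶻ i) -ᶻ 1ℤ
      cancel = solve-∀
      eq : ∀ i j r → ((1ℤ +ᶻ j +ᶻ r) +ᶻ (1ℤ +ᶻ j +ᶻ r)) -ᶻ (i +ᶻ i) -ᶻ 1ℤ ≡ -ᶻ (i +ᶻ i) -ᶻ (-ᶻ (j +ᶻ j)) +ᶻ (1ℤ +ᶻ (r +ᶻ r))
      eq = solve-∀

data Split (L : ℕ) : ℕ → Set where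
  low  : ∀ {i} → i < L → Split L i
  high : ∀ i → Split L (L + i)

split : ∀ L i → Split L i
split L i with i ℕ.<? L
... | yes i<L = low i<L
... | no i≮L = subst (Split L) (ℕ.m+[n∸m]≡n (ℕ.≮⇒≥ i≮L)) (high (i ∸ L))

module Join {H₁ H₂} (R₁ : Realization H₁) (R₂ : Realization H₂) where
  private
    module R₁ = Realization R₁
    module R₂ = Realization R₂
    L = R₁.size

    high≮ : ∀ i → ¬ (L + i < L)
    high≮ i = ℕ.≤⇒≯ (ℕ.m≤m+n L i)

  joinWith : {A : Set} → (ℕ → A) → (ℕ → A) → ℕ → A
  joinWith f g i = if i <ᵇ L then f i else g (i ∸ L)

  joinWith-low : {A : Set} (f g : ℕ → A) → ∀ {i} → i < L → joinWith f g i ≡ f i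
  joinWith-low f g i<L rewrite <ᵇ-yes i<L = refl

  joinWith-high : {A : Set} (f g : ℕ → A) → ∀ i → joinWith f g (L + i) ≡ g i
  joinWith-high f g i rewrite <ᵇ-no (high≮ i) | ℕ.m+n∸m≡n L i = refl

  -- Across the junction the later vertex wins, so no upset crosses it. Later scores and later
  -- indices both grow by `L`, which preserves the normalized entries.
  beats : ℕ → ℕ → Bool
  beats = joinWith (λ i → joinWith (R₁.beats i) (λ _ → false)) (λ i → joinWith (λ _ → true) (R₂.beats i))

  beats-ll : ∀ {i j} → i < L → j < L → beats i j ≡ R₁.beats i j
  beats-ll i<L j<L rewrite <ᵇ-yes i<L | <ᵇ-yes j<L = refl

  beats-lh : ∀ {i} → i < L → ∀ j → beats i (L + j) ≡ false
  beats-lh i<L j rewrite <ᵇ-yes i<L | <ᵇ-no (high≮ j) = refl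

  beats-hl : ∀ i {j} → j < L → beats (L + i) j ≡ true
  beats-hl i j<L rewrite <ᵇ-no (high≮ i) | <ᵇ-yes j<L = refl

  beats-hh : ∀ i j → beats (L + i) (L + j) ≡ R₂.beats i j
  beats-hh i j rewrite <ᵇ-no (high≮ i) | <ᵇ-no (high≮ j) | ℕ.m+n∸m≡n L i | ℕ.m+n∸m≡n L j = refl

  tournament : Tournament beats
  tournament = record { irrefl = irrefl ; anti = λ {i} {j} → anti i j }
    where
    irrefl : ∀ i → beats i i ≡ false
    irrefl i with split L i
    ... | low i<L = trans (beats-ll i<L i<L) (Tournament.irrefl R₁.tournament i)
    ... | high i = trans (beats-hh i i) (Tournament.irrefl R₂.tournament i)

    anti : ∀ i j → i ≢ j → beats j i ≡ not (beats i j)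
    anti i j i≢j with split L i | split L j
    ... | low i<L | low j<L = trans (beats-ll j<L i<L)
            (trans (Tournament.anti R₁.tournament i≢j) (cong not (sym (beats-ll i<L j<L))))
    ... | low i<L | high j = trans (beats-hl j i<L) (cong not (sym (beats-lh i<L j)))
    ... | high i | low j<L = trans (beats-lh j<L i) (cong not (sym (beats-hl i j<L)))
    ... | high i | high j = trans (beats-hh j i)
            (trans (Tournament.anti R₂.tournament (i≢j ∘ cong (λ x → L + x))) (cong not (sym (beats-hh i j))))

  size : ℕ
  size = L + R₂.size

  score-low : ∀ {i} → i < L → score size beats i ≡ score L R₁.beats i
  score-low {i} i<L = begin
    score size beats i
      ≡⟨ ∑-split L R₂.size (λ j → ι (beats i j)) ⟩
    ∑ L (λ j → ι (beats i j)) +ᶻ ∑ R₂.size (λ j → ι (beats i (L + j)))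
      ≡⟨ cong₂ _+ᶻ_ (∑-cong {L} (cong ι ∘ beats-ll i<L))
                    (trans (∑-cong {R₂.size} (λ {j} _ → cong ι (beats-lh i<L j))) (∑-zero R₂.size)) ⟩
    score L R₁.beats i +ᶻ 0ℤ
      ≡⟨ ℤ.+-identityʳ _ ⟩
    score L R₁.beats i ∎
    where open ≡-Reasoning

  score-high : ∀ i → score size beats (L + i) ≡ + L +ᶻ score R₂.size R₂.beats i
  score-high i = trans (∑-split L R₂.size (λ j → ι (beats (L + i) j)))
    (cong₂ _+ᶻ_ (trans (∑-cong {L} (cong ι ∘ beats-hl i)) (∑-1 L))
                (∑-cong {R₂.size} (λ {j} _ → cong ι (beats-hh i j))))

  -- Each certificate is scaled by the cost of the other to reach a common cost.
  cost bound : ℤ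
  cost  = R₁.cost *ᶻ R₂.cost
  bound = R₂.cost *ᶻ R₁.bound +ᶻ R₁.cost *ᶻ R₂.bound

  -- The first potential is lowered until no arc across the junction pays off.
  potential₁ potential₂ potential : ℕ → ℤ
  potential₁ i = R₂.cost *ᶻ R₁.potential i -ᶻ R₁.cost *ᶻ R₂.bound
  potential₂ i = R₁.cost *ᶻ R₂.potential i
  potential    = joinWith potential₁ potential₂

  potential-low : ∀ {i} → i < L → potential i ≡ potential₁ i
  potential-low = joinWith-low potential₁ potential₂

  potential-high : ∀ i → potential (L + i) ≡ potential₂ i
  potential-high = joinWith-high potential₁ potential₂

  private
    instance
      cost₁-positive : ℤ.Positive R₁.cost
      cost₁-positive = ℤ.positive R₁.cost>0
      cost₂-positive : ℤ.Positive R₂.cost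
      cost₂-positive = ℤ.positive R₂.cost>0
      cost₁-nonNeg : ℤ.NonNegative R₁.cost
      cost₁-nonNeg = ℤ.nonNegative (ℤ.<⇒≤ R₁.cost>0)
      cost₂-nonNeg : ℤ.NonNegative R₂.cost
      cost₂-nonNeg = ℤ.nonNegative (ℤ.<⇒≤ R₂.cost>0)

    *-nonneg : ∀ x {y} .{{_ : ℤ.NonNegative x}} → 0ℤ ≤ᶻ y → 0ℤ ≤ᶻ x *ᶻ y
    *-nonneg x {y} 0≤y = subst (_≤ᶻ x *ᶻ y) (ℤ.*-zeroʳ x) (ℤ.*-monoˡ-≤-nonNeg x 0≤y)

    *-nonpos : ∀ x {y} .{{_ : ℤ.NonNegative x}} → y ≤ᶻ 0ℤ → x *ᶻ y ≤ᶻ 0ℤ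
    *-nonpos x {y} y≤0 = subst (x *ᶻ y ≤ᶻ_) (ℤ.*-zeroʳ x) (ℤ.*-monoˡ-≤-nonNeg x y≤0)

  cost>0 : 0ℤ <ᶻ cost
  cost>0 = subst (_<ᶻ cost) (ℤ.*-zeroʳ R₁.cost) (ℤ.*-monoˡ-<-pos R₁.cost R₂.cost>0)

  diff-low : ∀ {i j} → i < L → j < L →
    R₂.cost *ᶻ (R₁.potential i -ᶻ R₁.potential j) ≡ potential i -ᶻ potential j
  diff-low {i} {j} i<L j<L = trans (eq R₂.cost (R₁.potential i) (R₁.potential j) (R₁.cost *ᶻ R₂.bound))
    (sym (cong₂ _-ᶻ_ (potential-low i<L) (potential-low j<L)))
    where
    eq : ∀ c x y b → c *ᶻ (x -ᶻ y) ≡ (c *ᶻ x -ᶻ b) -ᶻ (c *ᶻ y -ᶻ b)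
    eq = solve-∀

  diff-high : ∀ i j → R₁.cost *ᶻ (R₂.potential i -ᶻ R₂.potential j) ≡ potential (L + i) -ᶻ potential (L + j)
  diff-high i j = trans (eq R₁.cost (R₂.potential i) (R₂.potential j))
    (sym (cong₂ _-ᶻ_ (potential-high i) (potential-high j)))
    where
    eq : ∀ c x y → c *ᶻ (x -ᶻ y) ≡ c *ᶻ x -ᶻ c *ᶻ y
    eq = solve-∀

  -- The lowered first potential is nowhere above the second one, so the difference is at most 0 and
  -- thus below the cost.
  crossing-expensive : ∀ {i j} → i < L → j < R₂.size → potential i -ᶻ potential (L + j) <ᶻ cost
  crossing-expensive {i} {j} i<L j<M = ℤ.≤-<-trans
    (subst (_≤ᶻ 0ℤ) (trans (eq R₂.cost R₁.cost (R₁.potential i) R₂.bound (R₂.potential j))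
                           (sym (cong₂ _-ᶻ_ (potential-low i<L) (potential-high j))))
      (ℤ.+-mono-≤ (*-nonpos R₂.cost (R₁.potential≤0 i<L))
                  (*-nonpos R₁.cost (ℤ.i≤j⇒i-j≤0 (R₂.-bound≤ j<M)))))
    cost>0
    where
    eq : ∀ c₂ c₁ x b y → c₂ *ᶻ x +ᶻ c₁ *ᶻ (-ᶻ b -ᶻ y) ≡ (c₂ *ᶻ x -ᶻ c₁ *ᶻ b) -ᶻ c₁ *ᶻ y
    eq = solve-∀

  cheap : ∀ {i j} → i < j → j < size → beats i j ≡ true → cost <ᶻ potential i -ᶻ potential j
  cheap {i} {j} i<j j<size i⟶j with split L i | split L j
  ... | low i<L | low j<L = subst₂ _<ᶻ_ (ℤ.*-comm R₂.cost R₁.cost) (diff-low i<L j<L)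
          (ℤ.*-monoˡ-<-pos R₂.cost (R₁.cheap i<j j<L (trans (sym (beats-ll i<L j<L)) i⟶j)))
  ... | low i<L | high j = case trans (sym i⟶j) (beats-lh i<L j) of λ ()
  ... | high i | low j<L = contradiction (ℕ.<-trans i<j j<L) (high≮ i)
  ... | high i | high j = subst (cost <ᶻ_) (diff-high i j)
          (ℤ.*-monoˡ-<-pos R₁.cost (R₂.cheap (ℕ.+-cancelˡ-< L _ _ i<j) (ℕ.+-cancelˡ-< L _ _ j<size)
            (trans (sym (beats-hh i j)) i⟶j)))

  expensive : ∀ {i j} → i < j → j < size → beats i j ≡ false → potential i -ᶻ potential j <ᶻ cost
  expensive {i} {j} i<j j<size i↛j with split L i | split L j
  ... | low i<L | low j<L = subst₂ _<ᶻ_ (diff-low i<L j<L) (ℤ.*-comm R₂.cost R₁.cost)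
          (ℤ.*-monoˡ-<-pos R₂.cost (R₁.expensive i<j j<L (trans (sym (beats-ll i<L j<L)) i↛j)))
  ... | low i<L | high j = crossing-expensive i<L (ℕ.+-cancelˡ-< L _ _ j<size)
  ... | high i | low j<L = contradiction (ℕ.<-trans i<j j<L) (high≮ i)
  ... | high i | high j = subst (_<ᶻ cost) (diff-high i j)
          (ℤ.*-monoˡ-<-pos R₁.cost (R₂.expensive (ℕ.+-cancelˡ-< L _ _ i<j) (ℕ.+-cancelˡ-< L _ _ j<size)
            (trans (sym (beats-hh i j)) i↛j)))

  potential≤0 : ∀ {i} → i < size → potential i ≤ᶻ 0ℤ
  potential≤0 {i} i<size with split L i
  ... | low i<L = subst (_≤ᶻ 0ℤ) (sym (potential-low i<L))
          (ℤ.+-mono-≤ (*-nonpos R₂.cost (R₁.potential≤0 i<L)) (ℤ.neg-mono-≤ (*-nonneg R₁.cost R₂.bound≥0)))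
  ... | high i = subst (_≤ᶻ 0ℤ) (sym (potential-high i))
          (*-nonpos R₁.cost (R₂.potential≤0 (ℕ.+-cancelˡ-< L _ _ i<size)))

  -bound≤ : ∀ {i} → i < size → -ᶻ bound ≤ᶻ potential i
  -bound≤ {i} i<size with split L i
  ... | low i<L = subst₂ _≤ᶻ_ (eq R₂.cost R₁.bound (R₁.cost *ᶻ R₂.bound)) (sym (potential-low i<L))
          (ℤ.+-monoˡ-≤ (-ᶻ (R₁.cost *ᶻ R₂.bound)) (ℤ.*-monoˡ-≤-nonNeg R₂.cost (R₁.-bound≤ i<L)))
    where
    eq : ∀ c b d → c *ᶻ (-ᶻ b) -ᶻ d ≡ -ᶻ (c *ᶻ b +ᶻ d)
    eq = solve-∀
  ... | high i = subst₂ _≤ᶻ_ (eq (R₂.cost *ᶻ R₁.bound) R₁.cost R₂.bound) (trans (ℤ.+-identityˡ _) (sym (potential-high i)))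
          (ℤ.+-mono-≤ (ℤ.neg-mono-≤ (*-nonneg R₂.cost R₁.bound≥0))
                      (ℤ.*-monoˡ-≤-nonNeg R₁.cost (R₂.-bound≤ (ℕ.+-cancelˡ-< L _ _ i<size))))
    where
    eq : ∀ x c b → -ᶻ x +ᶻ c *ᶻ (-ᶻ b) ≡ -ᶻ (x +ᶻ c *ᶻ b)
    eq = solve-∀

  realization : Realization (H₁ ++ H₂)
  realization = record
    { size = size
    ; beats = beats
    ; certificate = record
      { tournament = tournament ; cost = cost ; potential = potential
      ; cost>0 = cost>0 ; cheap = cheap ; expensive = expensive }
    ; bound = bound
    ; bound≥0 = ℤ.+-mono-≤ (*-nonneg R₂.cost R₁.bound≥0) (*-nonneg R₁.cost R₂.bound≥0)
    ; potential≤0 = potential≤0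
    ; -bound≤ = -bound≤
    ; scores = trans (applyUpTo-++ _ L R₂.size) (cong₂ _++_
        (trans (applyUpTo-cong L (λ {i} i<L → cong (_-ᶻ + i) (score-low i<L))) R₁.scores)
        (trans (applyUpTo-cong R₂.size (λ {i} _ →
          trans (cong (_-ᶻ + (L + i)) (score-high i)) (eq (+ L) (score R₂.size R₂.beats i) (+ i)))) R₂.scores))
    }
    where
    eq : ∀ l s i → (l +ᶻ s) -ᶻ (l +ᶻ i) ≡ s -ᶻ i
    eq = solve-∀

[]-realization : Realization []
[]-realization = record
  { size = 0
  ; beats = λ i j → j <ᵇ i
  ; certificate = record
    { tournament = record { irrefl = λ i → <ᵇ-no (ℕ.<-irrefl {i} refl) ; anti = anti }
    ; cost = 1ℤ ; potential = λ _ → 0ℤ ; cost>0 = ℤ.+<+ (s≤s z≤n)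
    ; cheap = λ _ () ; expensive = λ _ () }
  ; bound = 0ℤ ; bound≥0 = ℤ.≤-refl ; potential≤0 = λ () ; -bound≤ = λ () ; scores = refl }
  where
  anti : ∀ {i j} → i ≢ j → (i <ᵇ j) ≡ not (j <ᵇ i)
  anti {i} {j} i≢j with ℕ.<-cmp i j
  ... | tri< i<j _ _ rewrite <ᵇ-yes i<j | <ᵇ-no (ℕ.<-asym i<j) = refl
  ... | tri≈ _ i≡j _ = contradiction i≡j i≢j
  ... | tri> _ _ j<i rewrite <ᵇ-yes j<i | <ᵇ-no (ℕ.<-asym j<i) = refl

symmetric-realization : ∀ {H} → Symmetric H → Realization H
symmetric-realization (inj₁ (z , 1≤z , refl)) =
  -- A zero vector is the ramp with p = 0, up to an empty tail.
  subst Realization (List.++-identityʳ (replicate z 0ℤ)) (Band.realization 0 z 1≤z)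
symmetric-realization (inj₂ (p , z , _ , 1≤z , refl)) = Band.realization p z 1≤z

concat-realization : ∀ {Hs} → All Symmetric Hs → Realization (concat Hs)
concat-realization [] = []-realization
concat-realization (sym-H ∷ sym-Hs) = Join.realization (symmetric-realization sym-H) (concat-realization sym-Hs)

-- Matrices

ι-injective : ∀ {b c} → ι b ≡ ι c → b ≡ c
ι-injective {true}  {true}  _ = refl
ι-injective {false} {false} _ = refl

does-ι≟1 : ∀ b → does (ι b ℤ.≟ 1ℤ) ≡ b
does-ι≟1 true  = refl
does-ι≟1 false = refl

sumℤ-toList : ∀ n (f : ℕ → ℤ) → sumℤ (toList (tabulate {n = n} (f ∘ toℕ))) ≡ ∑ n f
sumℤ-toList zero    f = refl
sumℤ-toList (suc n) f = cong (f 0 +ᶻ_) (sumℤ-toList n (f ∘ suc))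

sumℤ-tabulate : ∀ n (f : ℕ → ℤ) → sumℤ (List.tabulate {n = n} (f ∘ toℕ)) ≡ ∑ n f
sumℤ-tabulate zero    f = refl
sumℤ-tabulate (suc n) f = cong (f 0 +ᶻ_) (sumℤ-tabulate n (f ∘ suc))

sumℤ-allFin : ∀ n (f : ℕ → ℤ) → sumℤ (List.map (f ∘ toℕ) (allFin n)) ≡ ∑ n f
sumℤ-allFin n f = trans (cong sumℤ (List.map-tabulate {n = n} id (f ∘ toℕ))) (sumℤ-tabulate n f)

sumℤ-++ : ∀ xs ys → sumℤ (xs ++ ys) ≡ sumℤ xs +ᶻ sumℤ ys
sumℤ-++ []       ys = sym (ℤ.+-identityˡ _)
sumℤ-++ (x ∷ xs) ys = trans (cong (x +ᶻ_) (sumℤ-++ xs ys)) (sym (ℤ.+-assoc x _ _))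

sumℤ-cartesianProduct : ∀ {A B : Set} (f : A × B → ℤ) xs ys →
  sumℤ (List.map f (cartesianProduct xs ys)) ≡ sumℤ (List.map (λ x → sumℤ (List.map (λ y → f (x , y)) ys)) xs)
sumℤ-cartesianProduct f []       ys = refl
sumℤ-cartesianProduct f (x ∷ xs) ys = begin
  sumℤ (List.map f (List.map (x ,_) ys ++ cartesianProduct xs ys))
    ≡⟨ cong sumℤ (List.map-++ f (List.map (x ,_) ys) _) ⟩
  sumℤ (List.map f (List.map (x ,_) ys) ++ List.map f (cartesianProduct xs ys))
    ≡⟨ sumℤ-++ (List.map f (List.map (x ,_) ys)) _ ⟩
  sumℤ (List.map f (List.map (x ,_) ys)) +ᶻ sumℤ (List.map f (cartesianProduct xs ys))
    ≡⟨ cong₂ _+ᶻ_ (cong sumℤ (sym (List.map-∘ ys))) (sumℤ-cartesianProduct f xs ys) ⟩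
  sumℤ (List.map (λ y → f (x , y)) ys) +ᶻ _ ∎
  where open ≡-Reasoning

length-filter : ∀ {A : Set} {P : Pred A 0ℓ} (P? : Decidable P) xs →
  + length (filter P? xs) ≡ sumℤ (List.map (ι ∘ does ∘ P?) xs)
length-filter P? [] = refl
length-filter P? (x ∷ xs) with does (P? x)
... | true  = cong (1ℤ +ᶻ_) (length-filter P? xs)
... | false = trans (length-filter P? xs) (sym (ℤ.+-identityˡ _))

module _ {n : ℕ} where

  matrix : (ℕ → ℕ → Bool) → Matrix n
  matrix a = tabulate λ i → tabulate λ j → ι (a (toℕ i) (toℕ j))

  entry-matrix : ∀ a i j → entry (matrix a) i j ≡ ι (a (toℕ i) (toℕ j))
  entry-matrix a i j = trans (cong (λ v → lookup v j) (Vec.lookup∘tabulate _ i)) (Vec.lookup∘tabulate _ j)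

  matrix-cong : ∀ {a b} → (∀ {i j} → i < n → j < n → a i j ≡ b i j) → matrix a ≡ matrix b
  matrix-cong a≡b = Vec.tabulate-cong λ i → Vec.tabulate-cong λ j → cong ι (a≡b (Fin.toℕ<n i) (Fin.toℕ<n j))

  matrix-injective : ∀ {a b} → matrix a ≡ matrix b → ∀ {i j} → i < n → j < n → a i j ≡ b i j
  matrix-injective {a} {b} eq i<n j<n =
    subst₂ (λ i j → a i j ≡ b i j) (Fin.toℕ-fromℕ< i<n) (Fin.toℕ-fromℕ< j<n)
      (ι-injective (trans (sym (entry-matrix a _ _)) (trans (cong (λ A → entry A _ _) eq) (entry-matrix b _ _))))

  rowSum-matrix : ∀ a i → rowSum (matrix a) i ≡ score n a (toℕ i)
  rowSum-matrix a i = trans (cong (sumℤ ∘ toList) (Vec.lookup∘tabulate _ i)) (sumℤ-toList n (λ j → ι (a (toℕ i) j)))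

  upsets-matrix : ∀ a → + upsets (matrix a) ≡ upsetSum n a
  upsets-matrix a = begin
    + upsets (matrix a)
      ≡⟨ length-filter (isUpset? (matrix a)) (cartesianProduct (allFin n) (allFin n)) ⟩
    sumℤ (List.map (ι ∘ does ∘ isUpset? (matrix a)) (cartesianProduct (allFin n) (allFin n)))
      ≡⟨ cong sumℤ (List.map-cong pointwise (cartesianProduct (allFin n) (allFin n))) ⟩
    sumℤ (List.map (λ (i , j) → u (toℕ i) (toℕ j)) (cartesianProduct (allFin n) (allFin n)))
      ≡⟨ sumℤ-cartesianProduct _ (allFin n) (allFin n) ⟩
    sumℤ (List.map (λ i → sumℤ (List.map (λ j → u (toℕ i) (toℕ j)) (allFin n))) (allFin n))
      ≡⟨ cong sumℤ (List.map-cong (λ i → sumℤ-allFin n (u (toℕ i))) (allFin n)) ⟩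
    sumℤ (List.map (λ i → ∑ n (u (toℕ i))) (allFin n))
      ≡⟨ sumℤ-allFin n (λ i → ∑ n (u i)) ⟩
    upsetSum n a ∎
    where
    open ≡-Reasoning
    u : ℕ → ℕ → ℤ
    u i j = χ i j *ᶻ ι (a i j)
    ι-∧ : ∀ b c → ι (b ∧ c) ≡ ι b *ᶻ ι c
    ι-∧ true  c = sym (ℤ.*-identityˡ (ι c))
    ι-∧ false c = sym (ℤ.*-zeroˡ (ι c))
    pointwise : ∀ ij → ι (does (isUpset? (matrix a) ij)) ≡ u (toℕ (proj₁ ij)) (toℕ (proj₂ ij))
    pointwise (i , j) = trans
      (cong (λ b → ι ((toℕ i <ᵇ toℕ j) ∧ b))
        (trans (cong (λ e → does (e ℤ.≟ 1ℤ)) (entry-matrix a i j)) (does-ι≟1 (a (toℕ i) (toℕ j)))))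
      (ι-∧ (toℕ i <ᵇ toℕ j) (a (toℕ i) (toℕ j)))

  matrix-tournament : ∀ {a} → Tournament a → IsTournament (matrix a)
  matrix-tournament {a} t = record { zero-one = zero-one ; A+Aᵀ≡J-I = A+Aᵀ≡J-I }
    where
    open Tournament t
    zero-one : ∀ i j → entry (matrix a) i j ≡ 0ℤ ⊎ entry (matrix a) i j ≡ 1ℤ
    zero-one i j with a (toℕ i) (toℕ j) | entry-matrix a i j
    ... | true  | eq = inj₂ eq
    ... | false | eq = inj₁ eq
    complement : ∀ b → ι b +ᶻ ι (not b) ≡ 1ℤ
    complement true  = refl
    complement false = refl
    A+Aᵀ≡J-I : ∀ i j → entry (matrix a) i j +ᶻ entry (matrix a) j i ≡ allOnes i j -ᶻ identity i j
    A+Aᵀ≡J-I i j = trans (cong₂ _+ᶻ_ (entry-matrix a i j) (entry-matrix a j i)) (main i j)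
      where
      main : ∀ i j → ι (a (toℕ i) (toℕ j)) +ᶻ ι (a (toℕ j) (toℕ i)) ≡ allOnes i j -ᶻ identity i j
      main i j with i Fin.≟ j
      ... | yes refl rewrite irrefl (toℕ i) = refl
      ... | no i≢j rewrite anti (i≢j ∘ Fin.toℕ-injective) = complement (a (toℕ i) (toℕ j))

  matrix∈𝒯 : ∀ {R : Vec ℤ n} {a} → Tournament a → (∀ i → score n a (toℕ i) ≡ lookup R i) → 𝒯 R (matrix a)
  matrix∈𝒯 {a = a} t scores = record
    { tournament = matrix-tournament t ; scores = λ i → trans (rowSum-matrix a i) (scores i) }

  -- Beyond n, later vertices beat earlier ones, which creates no upsets.
  beats : Matrix n → ℕ → ℕ → Bool
  beats A i j with i ℕ.<? n | j ℕ.<? n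
  ... | yes i<n | yes j<n = does (entry A (fromℕ< i<n) (fromℕ< j<n) ℤ.≟ 1ℤ)
  ... | yes _   | no _    = j <ᵇ i
  ... | no _    | _       = j <ᵇ i

  beats-bounded : ∀ A {i j} → i < j → beats A i j ≡ true → j < n
  beats-bounded A {i} {j} i<j bij with i ℕ.<? n | j ℕ.<? n
  ... | _ | yes j<n = j<n
  ... | yes _ | no _ with () ← trans (sym bij) (<ᵇ-no (ℕ.<-asym i<j))
  ... | no _ | no _ with () ← trans (sym bij) (<ᵇ-no (ℕ.<-asym i<j))

  module _ {A : Matrix n} (t : IsTournament A) where
    open IsTournament t

    beats-tournament : Tournament (beats A)
    beats-tournament = record { irrefl = irrefl ; anti = λ {i} {j} → anti i j }
      where
      irrefl-entry : ∀ i → does (entry A i i ℤ.≟ 1ℤ) ≡ false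
      irrefl-entry i with zero-one i i
      ... | inj₁ eq = cong (λ e → does (e ℤ.≟ 1ℤ)) eq
      ... | inj₂ eq with () ← trans (sym (cong₂ _+ᶻ_ eq eq)) (trans (A+Aᵀ≡J-I i i)
                         (cong (λ b → 1ℤ -ᶻ (if b then 1ℤ else 0ℤ)) (dec-true (i Fin.≟ i) refl)))

      irrefl : ∀ i → beats A i i ≡ false
      irrefl i with i ℕ.<? n
      ... | yes i<n = irrefl-entry (fromℕ< i<n)
      ... | no _ = <ᵇ-no (ℕ.<-irrefl {i} refl)

      anti-entry : ∀ i j → i ≢ j → does (entry A j i ℤ.≟ 1ℤ) ≡ not (does (entry A i j ℤ.≟ 1ℤ))
      anti-entry i j i≢j with zero-one i j | zero-one j i
        | trans (A+Aᵀ≡J-I i j) (cong (λ b → 1ℤ -ᶻ (if b then 1ℤ else 0ℤ)) (dec-false (i Fin.≟ j) i≢j))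
      ... | inj₁ p | inj₁ q | eq with () ← trans (sym (cong₂ _+ᶻ_ p q)) eq
      ... | inj₁ p | inj₂ q | _ rewrite p | q = refl
      ... | inj₂ p | inj₁ q | _ rewrite p | q = refl
      ... | inj₂ p | inj₂ q | eq with () ← trans (sym (cong₂ _+ᶻ_ p q)) eq

      anti-<ᵇ : ∀ i j → i ≢ j → (i <ᵇ j) ≡ not (j <ᵇ i)
      anti-<ᵇ i j i≢j with ℕ.<-≤-connex i j
      ... | inj₁ i<j = trans (<ᵇ-yes i<j) (cong not (sym (<ᵇ-no (ℕ.<-asym i<j))))
      ... | inj₂ j≤i = trans (<ᵇ-no (ℕ.≤⇒≯ j≤i)) (cong not (sym (<ᵇ-yes (ℕ.≤∧≢⇒< j≤i (i≢j ∘ sym)))))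

      anti : ∀ i j → i ≢ j → beats A j i ≡ not (beats A i j)
      anti i j i≢j with i ℕ.<? n | j ℕ.<? n
      ... | yes i<n | yes j<n = anti-entry _ _ (i≢j ∘ λ eq →
              trans (sym (Fin.toℕ-fromℕ< i<n)) (trans (cong toℕ eq) (Fin.toℕ-fromℕ< j<n)))
      ... | yes _ | no _ = anti-<ᵇ i j i≢j
      ... | no _ | yes _ = anti-<ᵇ i j i≢j
      ... | no _ | no _  = anti-<ᵇ i j i≢j

    matrix-beats : matrix (beats A) ≡ A
    matrix-beats = trans (Vec.tabulate-cong λ i →
        trans (Vec.tabulate-cong (λ j → ι-beats i j)) (Vec.tabulate∘lookup (lookup A i)))
      (Vec.tabulate∘lookup A)
      where
      ι-entry : ∀ i j → ι (does (entry A i j ℤ.≟ 1ℤ)) ≡ entry A i j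
      ι-entry i j with zero-one i j
      ... | inj₁ eq rewrite eq = refl
      ... | inj₂ eq rewrite eq = refl

      ι-beats : ∀ i j → ι (beats A (toℕ i) (toℕ j)) ≡ entry A i j
      ι-beats i j with toℕ i ℕ.<? n | toℕ j ℕ.<? n
      ... | yes i<n | yes j<n rewrite Fin.fromℕ<-toℕ i i<n | Fin.fromℕ<-toℕ j j<n = ι-entry i j
      ... | no i≮n | _ = contradiction (Fin.toℕ<n i) i≮n
      ... | yes _ | no j≮n = contradiction (Fin.toℕ<n j) j≮n

  beats-score : ∀ {R : Vec ℤ n} {A} → 𝒯 R A → ∀ i → score n (beats A) (toℕ i) ≡ lookup R i
  beats-score {A = A} A∈𝒯 i = trans (sym (rowSum-matrix (beats A) i))
    (trans (cong (λ B → rowSum B i) (matrix-beats (𝒯.tournament A∈𝒯))) (𝒯.scores A∈𝒯 i))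

-- Passing between minima, certificates and normalized score vectors

toList-tabulate : ∀ n {f : Fin n → ℤ} (g : ℕ → ℤ) → (∀ i → f i ≡ g (toℕ i)) → toList (tabulate f) ≡ applyUpTo g n
toList-tabulate zero    g f≡g = refl
toList-tabulate (suc n) g f≡g = cong₂ _∷_ (f≡g Fin.zero) (toList-tabulate n (g ∘ suc) (f≡g ∘ Fin.suc))

-- Besides the entries, the lengths agree; this identifies the size of a realization with the order
-- of the matrices.
toList-tabulate⁻¹ : ∀ m {n} (g : ℕ → ℤ) (f : Fin n → ℤ) → applyUpTo g m ≡ toList (tabulate f) →
  m ≡ n × (∀ i → g (toℕ i) ≡ f i)
toList-tabulate⁻¹ zero    {zero}  g f _ = refl , λ ()
toList-tabulate⁻¹ (suc m) {suc n} g f eq =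
  let m≡n , g≡f = toList-tabulate⁻¹ m (g ∘ suc) (f ∘ Fin.suc) (List.∷-injectiveʳ eq) in
  cong suc m≡n , λ { Fin.zero → List.∷-injectiveˡ eq ; (Fin.suc i) → g≡f i }

certificate⇒unique : ∀ {n} {R : Vec ℤ n} {a} → Certificate n a →
  (∀ i → score n a (toℕ i) ≡ lookup R i) → HasCardinality (Uₘᵢₙ R) 1
certificate⇒unique {n} {R} {a} c scores =
  matrix a ∷ [] , [] ∷ [] , refl , λ B → mk⇔ (λ { (here refl) → minimal }) (λ B∈U → here (only B∈U))
  where
  open Certificate c using (tournament)

  matrix-a∈𝒯 : 𝒯 R (matrix a)
  matrix-a∈𝒯 = matrix∈𝒯 tournament scores

  module Versus {B} (B∈𝒯 : 𝒯 R B) where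
    open Optimality c (beats-tournament (𝒯.tournament B∈𝒯)) (λ {i} i<n →
      subst (λ i → score n (beats B) i ≡ score n a i) (Fin.toℕ-fromℕ< i<n)
        (trans (beats-score B∈𝒯 (fromℕ< i<n)) (sym (scores (fromℕ< i<n))))) public

    upsets-B : upsetSum n (beats B) ≡ + upsets B
    upsets-B = trans (sym (upsets-matrix {n} (beats B))) (cong (+_ ∘ upsets {n}) (matrix-beats (𝒯.tournament B∈𝒯)))

  minimal : Uₘᵢₙ R (matrix a)
  minimal = record
    { member = matrix-a∈𝒯
    ; minimum = λ B B∈𝒯 → ℤ.drop‿+≤+
        (subst₂ _≤ᶻ_ (sym (upsets-matrix {n} a)) (Versus.upsets-B B∈𝒯) (Versus.optimal B∈𝒯)) }

  only : ∀ {B} → Uₘᵢₙ R B → B ≡ matrix a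
  only {B} B∈U = trans (sym (matrix-beats (𝒯.tournament member))) (matrix-cong (Versus.unique member
    (subst₂ _≤ᶻ_ (sym (Versus.upsets-B member)) (upsets-matrix {n} a) (ℤ.+≤+ (minimum (matrix a) matrix-a∈𝒯)))))
    where open Uₘᵢₙ B∈U

-- A competitor with the same scores and no more upsets yields a matrix that is itself a minimum,
-- hence equal to `A`.
unique⇒optimal : ∀ {n} {R : Vec ℤ n} → Feasible R → ∀ {A} → Uₘᵢₙ R A →
  (∀ {B} → Uₘᵢₙ R B → B ≡ A) → Optimal n (beats A)
unique⇒optimal {n} {R} feasible {A} A∈U only = record
  { tournament = beats-tournament A-tournament
  ; bounded = beats-bounded A
  ; ordered = ordered
  ; unique = unique
  }
  where
  open Uₘᵢₙ A∈U
  A-tournament = 𝒯.tournament member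

  ordered : ∀ {k} → suc k < n → score n (beats A) k ≤ᶻ score n (beats A) (suc k)
  ordered {k} 1+k<n = subst₂ (λ i j → score n (beats A) i ≤ᶻ score n (beats A) j)
    (Fin.toℕ-fromℕ< k<n) (Fin.toℕ-fromℕ< 1+k<n)
    (subst₂ _≤ᶻ_ (sym (beats-score member _)) (sym (beats-score member _))
      (Feasible.nondecreasing feasible (fromℕ< k<n) (fromℕ< 1+k<n)
        (subst₂ _≤_ (sym (Fin.toℕ-fromℕ< k<n)) (sym (Fin.toℕ-fromℕ< 1+k<n)) (ℕ.n≤1+n k))))
    where
    k<n = ℕ.<-trans (ℕ.n<1+n k) 1+k<n

  unique : ∀ {b} → Tournament b → (∀ i → score n b i ≡ score n (beats A) i) →
    upsetSum n b ≤ᶻ upsetSum n (beats A) → ∀ {i j} → i < n → j < n → b i j ≡ beats A i j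
  unique {b} t same-scores fewer = matrix-injective {n} (trans (only b∈U) (sym (matrix-beats A-tournament)))
    where
    upsets-b≤ : upsets {n} (matrix b) ≤ upsets A
    upsets-b≤ = ℤ.drop‿+≤+ (subst₂ _≤ᶻ_ (sym (upsets-matrix {n} b))
      (trans (sym (upsets-matrix {n} (beats A))) (cong (+_ ∘ upsets {n}) (matrix-beats A-tournament))) fewer)
    b∈U : Uₘᵢₙ R (matrix b)
    b∈U = record
      { member = matrix∈𝒯 t (λ i → trans (same-scores (toℕ i)) (beats-score member i))
      ; minimum = λ B B∈𝒯 → ℕ.≤-trans upsets-b≤ (minimum B B∈𝒯) }

theorem1p5 : ∀ (n : ℕ) → 1 ≤ n → (R : Vec ℤ n) → Feasible R →
    HasCardinality (Uₘᵢₙ R) 1 ⇔ IsConcatenationOfSymmetric (toList (normalized R))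
theorem1p5 n 1≤n R feasible = mk⇔ decompose realize
  where
  decompose : HasCardinality (Uₘᵢₙ R) 1 → IsConcatenationOfSymmetric (toList (normalized R))
  decompose (A ∷ [] , _ , _ , A⇔) =
    -- The cut before vertex 0 is uncrossed because nothing lies below it.
    let Hs , sym-Hs , eq = segments n {0} {n} ℕ.≤-refl refl (λ ()) in
    Hs , nonempty n Hs 1≤n eq , sym-Hs ,
    trans (toList-tabulate n h (λ i → cong (_-ᶻ + toℕ i) (sym (beats-score (Uₘᵢₙ.member A∈U) i)))) eq
    where
    A∈U = Equivalence.to (A⇔ A) (here refl)
    only : ∀ {B} → Uₘᵢₙ R B → B ≡ A
    only B∈U with Equivalence.from (A⇔ _) B∈U
    ... | here B≡A = B≡A
    open Segments (Optimal.rigid (unique⇒optimal feasible A∈U only))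
    nonempty : ∀ n Hs → 1 ≤ n → ∀ {f : ℕ → ℤ} → applyUpTo f n ≡ concat Hs → 1 ≤ length Hs
    nonempty (suc _) (_ ∷ _) _ _ = s≤s z≤n

  realize : IsConcatenationOfSymmetric (toList (normalized R)) → HasCardinality (Uₘᵢₙ R) 1
  realize (Hs , _ , sym-Hs , eq) =
    -- Equality with the normalized scores fixes the size and, once the index is cancelled, the
    -- scores themselves.
    let size≡n , h≡ = toList-tabulate⁻¹ size _ _ (trans scores (sym eq)) in
    transport size≡n certificate λ i → ∙-cancelʳ (-ᶻ + toℕ i) _ _ (h≡ i)
    where
    open Realization (concat-realization sym-Hs) renaming (beats to a)
    transport : ∀ {m a} → m ≡ n → Certificate m a → (∀ i → score m a (toℕ i) ≡ lookup R i) → HasCardinality (Uₘᵢₙ R) 1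
    transport refl = certificate⇒unique
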